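{- Let $h\geq 3$ and $k$ be positive integers, and let $A$ be a finite set of $k$ integers with $\min(A)=0$ and $\gcd(A)=1$. (1) If $k\geq 3h+1$ and $|h^{\wedge}A| = hk-h^{2}+2$, then $A\subseteq [0,k]$. (2) If $k\geq 3h+3$ and $|h^{\wedge}A| = hk-h^{2}+3$, then $A\subseteq [0,k+1]$. (3) If $k\geq 3h+4$ and $|h^{\wedge}A| = hk-h^{2}+4$, then $A\subseteq [0,k+2]$.
   Context: For a finite set $A$ of integers and a positive integer $h\le |A|$, the restricted $h$-fold sumset $h^{\wedge}A$ is the set of all sums of $h$ distinct elements of $A$. For integers $\alpha\le\beta$, $[\alpha,\beta]=\{x\in\mathbb{Z}:\alpha\le x\le\beta\}$. $\gcd(A)$ denotes the greatest common divisor of the elements of $A$. -}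

module Defs where

open import Data.Nat as ℕ using (ℕ)
open import Data.Nat.GCD using (gcd)
open import Data.Integer using (ℤ; +_; ∣_∣; _≤_)
import Data.Integer as ℤ
open import Data.List using (List; []; _∷_; length; foldr)
open import Data.List.Membership.Propositional using (_∈_)
open import Data.List.Relation.Unary.Unique.Propositional using (Unique)
open import Data.List.Relation.Binary.Sublist.Propositional using (_⊆_)
open import Data.Product using (Σ; _×_; ∃)
open import Function.Bundles using (_⇔_)
open import Relation.Binary.PropositionalEquality using (_≡_)

sumℤ : List ℤ → ℤ
sumℤ = foldr ℤ._+_ (+ 0)

-- A finite set of integers is represented by a duplicate-free list.
-- s ∈ h^A : s is the sum of h distinct elements of A, i.e. the sum of a
-- sublist of length h of the duplicate-free list A.
InRestrictedSumset : ℕ → List ℤ → ℤ → Set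
InRestrictedSumset h A s = Σ (List ℤ) λ B → (B ⊆ A) × (length B ≡ h) × (sumℤ B ≡ s)

HasCard : (ℤ → Set) → ℕ → Set
HasCard P n = Σ (List ℤ) λ L → Unique L × (∀ x → (x ∈ L) ⇔ P x) × (length L ≡ n)

gcdList : List ℤ → ℕ
gcdList = foldr (λ a g → gcd ∣ a ∣ g) 0

MinIsZero : List ℤ → Set
MinIsZero A = (+ 0 ∈ A) × (∀ a → a ∈ A → + 0 ≤ a)

SubsetInterval : List ℤ → ℤ → ℤ → Set
SubsetInterval A α β = ∀ a → a ∈ A → (α ≤ a) × (a ≤ β)

{-# OPTIONS --safe #-}

-- Write A as an increasing sequence a and let w - 1 be the excess of |h^A| over the minimum h (|A| - h) + 1.
-- Claim: A lies in an arithmetic progression of |A| + w - 1 terms; when 0 ∈ A and gcd A = 1 its difference is 1.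
--
-- h = 2. If A ⊆ [0, ℓ] with ℓ ≤ 2 |A| - 5, then modulo ℓ every residue is a sum of two distinct elements, which gives
-- |2^A| ≥ ℓ + |A| - 2.  In general, deleting the largest element either lowers the excess, and induction applies
-- to the rest, or every sum with the deleted element, except the two largest, is already a sum of others.  If the
-- latter happens twice in a row, the last four gaps are equal and their length divides all differences; the same
-- holds at the other end by reflection, and the remaining gaps are few enough to be controlled directly.
--
-- h > 2. The h-fold sums using the largest element M carry the (h - 1)-fold sums of A ∖ {M}; below them lie the sums
-- of the h - 1 least elements and one more.  So the excess of A ∖ {M} is at most that of A, and likewise for A without
-- its least element; hence A is nearly an interval of a progression.  Then two-term sums fill the gap below M, so
-- that its interior points are also paid for by the excess.

module Submission where

open import Defs
open import Data.Nat as ℕ using (ℕ; zero; suc; _+_; _*_; _∸_; _≤_; _<_; _≥_; _>_; z≤n; s≤s; _≟_; _<?_; _≤?_)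
open import Data.Nat.Properties using
  (≤-refl; ≤-reflexive; ≤-trans; ≤-antisym; m≤n⇒m<n∨m≡n; +-assoc; +-cancelˡ-≤; +-cancelʳ-≤; ≤∧≢⇒<; n≤0⇒n≡0;
   ≤-decTotalOrder; +-monoˡ-≤; *-monoʳ-≤; *-cancelˡ-≤; *-distribˡ-+; *-monoˡ-≤; *-identityʳ; *-suc; n∸n≡0;
   n≤1+n; +-monoʳ-≤; *-comm; m+[n∸m]≡n; +-monoʳ-<; +-mono-≤; +-cancelˡ-<; +-cancelˡ-≡; *-cancelˡ-<;
   *-cancelˡ-≡; *-zeroʳ; m+n∸m≡n; m∸n+n≡m; m∸n≤m; ∸-monoʳ-<; ∸-cancelˡ-≡; suc-injective; +-identityʳ; <-irrefl;
   <-trans; ≮⇒≥; ≰⇒>; <⇒≤; <⇒≢; n<1+n; m≤m+n; m≤n+m; +-comm; +-suc; anyUpTo?)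
open import Data.Integer as ℤ using (ℤ; +_; -[1+_])
import Data.Integer.Properties as ℤ
import Data.Integer.Tactic.RingSolver as ℤ-Solver
open import Data.Nat.Tactic.RingSolver using (solve-∀)
open import Data.Nat.Divisibility using (_∣_; _∣?_; divides; ∣m+n∣m⇒∣n; ∣-antisym; _∣0; ∣1⇒≡1; m∣m*n)
open import Data.Nat.GCD using (gcd-greatest)
open import Data.Nat.ListAction using (sum)
open import Data.Nat.ListAction.Properties using (sum-↭)
open import Data.Bool using (Bool; true; false; _∧_; _∨_; if_then_else_)
open import Data.Maybe using (Maybe; just; nothing)
open import Data.Empty using (⊥; ⊥-elim)
open import Data.Fin as Fin using (Fin)
open import Data.List using (List; []; _∷_; length; map; _++_; concatMap; applyUpTo)
open import Data.List.Properties using (length-++; length-map; length-applyUpTo)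
open import Data.List.Relation.Unary.All as All using (All; []; _∷_)
import Data.List.Relation.Unary.All.Properties as All
open import Data.List.Relation.Unary.AllPairs as AllPairs using (AllPairs; []; _∷_)
open import Data.List.Relation.Unary.Any using (here; there)
open import Data.List.Relation.Unary.Linked.Properties using (Linked⇒AllPairs)
open import Data.List.Relation.Binary.Permutation.Propositional using
  (_↭_; prep; swap; ↭-sym; ↭⇒↭ₛ)
  renaming (refl to ↭-refl; trans to ↭-trans)
open import Data.List.Relation.Binary.Permutation.Propositional.Properties using (↭-length; ∈-resp-↭)
open import Data.List.Relation.Binary.Permutation.Setoid.Properties using (Unique-resp-↭)
open import Data.List.Relation.Binary.Sublist.Propositional using (_⊆_; []; _∷_; _∷ʳ_; minimum)
import Data.List.Relation.Binary.Sublist.Propositional.Properties as Sublist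
import Data.List.Sort
open import Data.List.Relation.Unary.Unique.Propositional using (Unique)
import Data.List.Relation.Unary.Unique.Propositional.Properties as Unique
open import Data.List.Membership.Propositional using (_∈_)
open import Data.List.Membership.Propositional.Properties using
  (∈-applyUpTo⁻; ∈-∃++; ∈-++⁺ˡ; ∈-++⁺ʳ; ∈-++⁻; ∈-map⁺; ∈-map⁻)
open import Data.Product using (∃; ∃-syntax; _×_; _,_; proj₁; proj₂)
open import Data.Sum as Sum using (_⊎_; inj₁; inj₂; [_,_]′)
open import Data.Vec as Vec using (Vec; []; _∷_; lookup)
open import Data.Vec.N-ary using (N-ary; _$ⁿ_)
open import Function using (_∘_; id)
open import Function.Bundles using (Equivalence)
import Relation.Binary.Construct.Flip.EqAndOrd as Flip
open import Relation.Nullary using (¬_; Dec; yes; no; contradiction)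
import Relation.Nullary.Decidable as Dec
open import Relation.Nullary.Decidable using (_×-dec_; True; toWitness; ¬?; decidable-stable)
open import Relation.Binary.PropositionalEquality using
  (_≡_; _≢_; refl; sym; trans; cong; cong₂; subst; subst₂; setoid)

-- Linear arithmetic over ℕ

module Linear where

  infixl 7 _:*_
  infixl 6 _:+_
  infix 4 _:≤_ _:<_ _:≡_
  infixr 2 _⇒_
  infixr 7 _⊙_
  infixl 6 _⊕_

  data Expr (n : ℕ) : Set where
    con : ℕ → Expr n
    var : Fin n → Expr n
    _:+_ : Expr n → Expr n → Expr n
    _:*_ : ℕ → Expr n → Expr n

  data Atom (n : ℕ) : Set where
    _:≤_ _:<_ _:≡_ : Expr n → Expr n → Atom n

  data Sequent (n : ℕ) : Set where
    _⇒_ : Atom n → Sequent n → Sequent n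
    ⊢_ : Atom n → Sequent n
    ⊢⊥ : Sequent n

  infix 3 ⊢_

  ⟦_⟧ : ∀ {n} → Expr n → Vec ℕ n → ℕ
  ⟦ con c ⟧ ρ = c
  ⟦ var i ⟧ ρ = lookup ρ i
  ⟦ e :+ f ⟧ ρ = ⟦ e ⟧ ρ + ⟦ f ⟧ ρ
  ⟦ c :* e ⟧ ρ = c * ⟦ e ⟧ ρ

  ⟦_⟧ₐ : ∀ {n} → Atom n → Vec ℕ n → Set
  ⟦ e :≤ f ⟧ₐ ρ = ⟦ e ⟧ ρ ≤ ⟦ f ⟧ ρ
  ⟦ e :< f ⟧ₐ ρ = ⟦ e ⟧ ρ < ⟦ f ⟧ ρ
  ⟦ e :≡ f ⟧ₐ ρ = ⟦ e ⟧ ρ ≡ ⟦ f ⟧ ρ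

  ⟦_⟧ₛ : ∀ {n} → Sequent n → Vec ℕ n → Set
  ⟦ a ⇒ s ⟧ₛ ρ = ⟦ a ⟧ₐ ρ → ⟦ s ⟧ₛ ρ
  ⟦ ⊢ a ⟧ₛ ρ = ⟦ a ⟧ₐ ρ
  ⟦ ⊢⊥ ⟧ₛ ρ = ⊥

  -- Coefficients of the atoms, followed by the constant term.
  Form : ℕ → Set
  Form n = Vec ℤ (suc n)

  eval : ∀ {n} → Form n → Vec ℕ n → ℤ
  eval (c ∷ _) [] = c
  eval (c ∷ cs) (x ∷ ρ) = c ℤ.* + x ℤ.+ eval cs ρ

  Holds : ∀ {n} → Vec ℕ n → Form n → Set
  Holds ρ f = + 0 ℤ.≤ eval f ρ

  _⊕_ : ∀ {n} → Form n → Form n → Form n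
  _⊕_ = Vec.zipWith ℤ._+_

  _⊙_ : ∀ {n} → ℤ → Form n → Form n
  a ⊙ f = Vec.map (a ℤ.*_) f

  constant : ∀ n → ℤ → Form n
  constant zero c = c ∷ []
  constant (suc n) c = + 0 ∷ constant n c

  variable-form : ∀ {n} → Fin n → Form n
  variable-form {suc n} Fin.zero = + 1 ∷ constant n (+ 0)
  variable-form (Fin.suc i) = + 0 ∷ variable-form i

  private
    ring₁ : ∀ a b x p q → (a ℤ.+ b) ℤ.* x ℤ.+ (p ℤ.+ q) ≡ (a ℤ.* x ℤ.+ p) ℤ.+ (b ℤ.* x ℤ.+ q)
    ring₁ = ℤ-Solver.solve-∀

    ring₂ : ∀ a c x p → (a ℤ.* c) ℤ.* x ℤ.+ a ℤ.* p ≡ a ℤ.* (c ℤ.* x ℤ.+ p)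
    ring₂ = ℤ-Solver.solve-∀

    ring₃ : ∀ x c → + 0 ℤ.* x ℤ.+ c ≡ c
    ring₃ = ℤ-Solver.solve-∀

    ring₄ : ∀ x → + 1 ℤ.* x ℤ.+ + 0 ≡ x
    ring₄ = ℤ-Solver.solve-∀

    ring₅ : ∀ a b x p q → b ℤ.* (a ℤ.* x ℤ.+ p) ℤ.+ a ℤ.* (ℤ.- b ℤ.* x ℤ.+ q)
                        ≡ b ℤ.* p ℤ.+ a ℤ.* q
    ring₅ = ℤ-Solver.solve-∀

    ring₆ : ∀ b x q → b ℤ.* x ℤ.+ (ℤ.- b ℤ.* x ℤ.+ q) ≡ q
    ring₆ = ℤ-Solver.solve-∀

    ring₇ : ∀ x y → x ℤ.+ -[1+ 0 ] ℤ.* y ≡ x ℤ.- y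
    ring₇ = ℤ-Solver.solve-∀

    ring₈ : ∀ a b x p q → a ℤ.* q ℤ.+ ℤ.- b ℤ.* p ≡ a ℤ.* (b ℤ.* x ℤ.+ q) ℤ.- b ℤ.* (a ℤ.* x ℤ.+ p)
    ring₈ = ℤ-Solver.solve-∀

    ring₈′ : ∀ a b x p q → a ℤ.* q ℤ.+ b ℤ.* p ≡ a ℤ.* (b ℤ.* x ℤ.+ q) ℤ.+ b ℤ.* (ℤ.- a ℤ.* x ℤ.+ p)
    ring₈′ = ℤ-Solver.solve-∀

    ring₉ : ∀ b z → z ℤ.- b ℤ.* + 0 ≡ z
    ring₉ = ℤ-Solver.solve-∀

    ring₉′ : ∀ b z → z ℤ.+ b ℤ.* + 0 ≡ z
    ring₉′ = ℤ-Solver.solve-∀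

  eval-⊕ : ∀ {n} (f g : Form n) ρ → eval (f ⊕ g) ρ ≡ eval f ρ ℤ.+ eval g ρ
  eval-⊕ (a ∷ _) (b ∷ _) [] = refl
  eval-⊕ (a ∷ f) (b ∷ g) (x ∷ ρ) rewrite eval-⊕ f g ρ =
    ring₁ a b (+ x) (eval f ρ) (eval g ρ)

  eval-⊙ : ∀ {n} a (f : Form n) ρ → eval (a ⊙ f) ρ ≡ a ℤ.* eval f ρ
  eval-⊙ a (c ∷ _) [] = refl
  eval-⊙ a (c ∷ f) (x ∷ ρ) rewrite eval-⊙ a f ρ = ring₂ a c (+ x) (eval f ρ)

  eval-constant : ∀ n c ρ → eval (constant n c) ρ ≡ c
  eval-constant zero c [] = refl
  eval-constant (suc n) c (x ∷ ρ) rewrite eval-constant n c ρ = ring₃ (+ x) c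

  eval-variable : ∀ {n} (i : Fin n) ρ → eval (variable-form i) ρ ≡ + lookup ρ i
  eval-variable {suc n} Fin.zero (x ∷ ρ) rewrite eval-constant n (+ 0) ρ = ring₄ (+ x)
  eval-variable (Fin.suc i) (x ∷ ρ) rewrite eval-variable i ρ = ring₃ (+ x) (+ lookup ρ i)

  form : ∀ {n} → Expr n → Form n
  form (con c) = constant _ (+ c)
  form (var i) = variable-form i
  form (e :+ f) = form e ⊕ form f
  form (c :* e) = + c ⊙ form e

  eval-form : ∀ {n} (e : Expr n) ρ → eval (form e) ρ ≡ + ⟦ e ⟧ ρ
  eval-form (con c) ρ = eval-constant _ (+ c) ρ
  eval-form (var i) ρ = eval-variable i ρ
  eval-form (e :+ f) ρ rewrite eval-⊕ (form e) (form f) ρ | eval-form e ρ | eval-form f ρ = refl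
  eval-form (c :* e) ρ rewrite eval-⊙ (+ c) (form e) ρ | eval-form e ρ = sym (ℤ.pos-* c (⟦ e ⟧ ρ))

  difference : ∀ {n} → Expr n → Expr n → Form n
  difference f e = form f ⊕ (-[1+ 0 ] ⊙ form e)

  difference-holds : ∀ {n} (e f : Expr n) ρ → ⟦ e ⟧ ρ ≤ ⟦ f ⟧ ρ → Holds ρ (difference f e)
  difference-holds e f ρ e≤f
    rewrite eval-⊕ (form f) (-[1+ 0 ] ⊙ form e) ρ | eval-⊙ -[1+ 0 ] (form e) ρ
          | eval-form e ρ | eval-form f ρ | ring₇ (+ ⟦ f ⟧ ρ) (+ ⟦ e ⟧ ρ) =
    ℤ.i≤j⇒0≤j-i (ℤ.+≤+ e≤f)

  difference-vanishes : ∀ {n} (e f : Expr n) ρ → ⟦ e ⟧ ρ ≡ ⟦ f ⟧ ρ → eval (difference f e) ρ ≡ + 0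
  difference-vanishes e f ρ e≡f
    rewrite eval-⊕ (form f) (-[1+ 0 ] ⊙ form e) ρ | eval-⊙ -[1+ 0 ] (form e) ρ
          | eval-form e ρ | eval-form f ρ | ring₇ (+ ⟦ f ⟧ ρ) (+ ⟦ e ⟧ ρ) =
    ℤ.i≡j⇒i-j≡0 (cong +_ (sym e≡f))

  -- A positive head coefficient bounds the variable from below, a negative one from above;
  -- crosswise scaling by positive factors removes it.
  combine : ∀ {n} → Form (suc n) → Form (suc n) → List (Form n)
  combine (ℤ.+[1+ a ] ∷ f) (-[1+ b ] ∷ g) = ((ℤ.+[1+ b ] ⊙ f) ⊕ (ℤ.+[1+ a ] ⊙ g)) ∷ []
  combine _ _ = []

  -- Atoms are natural numbers, so a negative head coefficient may be dropped.
  weaken : ∀ {n} → Form (suc n) → List (Form n)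
  weaken (+ 0 ∷ f) = f ∷ []
  weaken (ℤ.+[1+ _ ] ∷ f) = []
  weaken (-[1+ _ ] ∷ f) = f ∷ []

  eliminate : ∀ {n} → List (Form (suc n)) → List (Form n)
  eliminate fs = concatMap weaken fs ++ concatMap (λ f → concatMap (combine f) fs) fs

  pivot : ∀ {n} → List (Form (suc n)) → Maybe (Form (suc n))
  pivot [] = nothing
  pivot ((+ 0 ∷ f) ∷ fs) = pivot fs
  pivot (f ∷ fs) = just f

  -- The second form is scaled by the absolute value of the pivot's head coefficient, so that an
  -- inequality keeps its direction.
  cancel : ∀ {n} → Form (suc n) → Form (suc n) → Form n
  cancel (+ a ∷ f) (b ∷ g) = (+ a ⊙ g) ⊕ (ℤ.- b ⊙ f)
  cancel (-[1+ a ] ∷ f) (b ∷ g) = (ℤ.+[1+ a ] ⊙ g) ⊕ (b ⊙ f)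

  nonneg : ∀ {n} → Vec ℤ n → Bool
  nonneg [] = true
  nonneg (+ _ ∷ f) = nonneg f
  nonneg (-[1+ _ ] ∷ f) = false

  -- A form without negative coefficients holds at every natural point, so dropping it loses nothing
  -- and limits the growth of the elimination.
  prune : ∀ {n} → List (Form n) → List (Form n)
  prune [] = []
  prune (f ∷ fs) = if nonneg f then prune fs else f ∷ prune fs

  weaken-holds : ∀ {n} x (ρ : Vec ℕ n) f → Holds (x ∷ ρ) f → All (Holds ρ) (weaken f)
  weaken-holds x ρ (+ 0 ∷ f) h = subst (+ 0 ℤ.≤_) (ring₃ (+ x) (eval f ρ)) h ∷ []
  weaken-holds x ρ (ℤ.+[1+ _ ] ∷ f) h = []
  weaken-holds x ρ (-[1+ b ] ∷ f) h =
    subst (+ 0 ℤ.≤_) (ring₆ ℤ.+[1+ b ] (+ x) (eval f ρ)) (ℤ.+-mono-≤ 0≤bx h) ∷ []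
    where
    0≤bx : + 0 ℤ.≤ ℤ.+[1+ b ] ℤ.* + x
    0≤bx = subst (+ 0 ℤ.≤_) (ℤ.pos-* (suc b) x) (ℤ.+≤+ z≤n)

  combine-holds : ∀ {n} x (ρ : Vec ℕ n) f g → Holds (x ∷ ρ) f → Holds (x ∷ ρ) g →
                  All (Holds ρ) (combine f g)
  combine-holds x ρ (+ 0 ∷ f) g hf hg = []
  combine-holds x ρ (-[1+ _ ] ∷ f) g hf hg = []
  combine-holds x ρ (ℤ.+[1+ a ] ∷ f) (+ _ ∷ g) hf hg = []
  combine-holds x ρ (ℤ.+[1+ a ] ∷ f) (-[1+ b ] ∷ g) hf hg =
    subst (+ 0 ℤ.≤_) (sym combined) (ℤ.+-mono-≤ (scale b hf) (scale a hg)) ∷ []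
    where
    u = eval f ρ
    v = eval g ρ
    scale : ∀ c {i} → + 0 ℤ.≤ i → + 0 ℤ.≤ ℤ.+[1+ c ] ℤ.* i
    scale c {i} 0≤i = subst (ℤ._≤ ℤ.+[1+ c ] ℤ.* i) (ℤ.*-zeroʳ ℤ.+[1+ c ])
                        (ℤ.*-monoˡ-≤-nonNeg ℤ.+[1+ c ] 0≤i)
    combined : eval ((ℤ.+[1+ b ] ⊙ f) ⊕ (ℤ.+[1+ a ] ⊙ g)) ρ
          ≡ ℤ.+[1+ b ] ℤ.* (ℤ.+[1+ a ] ℤ.* + x ℤ.+ u) ℤ.+ ℤ.+[1+ a ] ℤ.* (-[1+ b ] ℤ.* + x ℤ.+ v)
    combined rewrite eval-⊕ (ℤ.+[1+ b ] ⊙ f) (ℤ.+[1+ a ] ⊙ g) ρ | eval-⊙ ℤ.+[1+ b ] f ρ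
              | eval-⊙ ℤ.+[1+ a ] g ρ = sym (ring₅ ℤ.+[1+ a ] ℤ.+[1+ b ] (+ x) u v)

  concatMap-All : ∀ {A B : Set} {P : A → Set} {Q : B → Set} (f : A → List B) →
                  (∀ x → P x → All Q (f x)) → ∀ {xs} → All P xs → All Q (concatMap f xs)
  concatMap-All f h [] = []
  concatMap-All f h (px ∷ pxs) = All.++⁺ (h _ px) (concatMap-All f h pxs)

  eliminate-holds : ∀ {n} x (ρ : Vec ℕ n) {fs} → All (Holds (x ∷ ρ)) fs → All (Holds ρ) (eliminate fs)
  eliminate-holds x ρ hs = All.++⁺
    (concatMap-All weaken (weaken-holds x ρ) hs)
    (concatMap-All _ (λ f hf → concatMap-All (combine f) (λ g → combine-holds x ρ f g hf) hs) hs)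

  Vanishes : ∀ {n} → Vec ℕ n → Form n → Set
  Vanishes ρ f = eval f ρ ≡ + 0

  pivot-vanishes : ∀ {n} (ρ : Vec ℕ (suc n)) {es p} → All (Vanishes ρ) es → pivot es ≡ just p → Vanishes ρ p
  pivot-vanishes ρ {(+ 0 ∷ f) ∷ es} (_ ∷ vs) eq = pivot-vanishes ρ vs eq
  pivot-vanishes ρ {(ℤ.+[1+ _ ] ∷ f) ∷ es} (v ∷ vs) refl = v
  pivot-vanishes ρ {(-[1+ _ ] ∷ f) ∷ es} (v ∷ vs) refl = v

  magnitude : ∀ {n} → Form (suc n) → ℕ
  magnitude (a ∷ f) = ℤ.∣ a ∣

  cancel-eval : ∀ {n} x (ρ : Vec ℕ n) p g → Vanishes (x ∷ ρ) p →
                eval (cancel p g) ρ ≡ + magnitude p ℤ.* eval g (x ∷ ρ)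
  cancel-eval x ρ (+ a ∷ f) (b ∷ g) v
    rewrite eval-⊕ (+ a ⊙ g) (ℤ.- b ⊙ f) ρ | eval-⊙ (+ a) g ρ | eval-⊙ (ℤ.- b) f ρ =
    trans (ring₈ (+ a) b (+ x) (eval f ρ) (eval g ρ))
      (trans (cong (λ z → + a ℤ.* (b ℤ.* + x ℤ.+ eval g ρ) ℤ.- b ℤ.* z) v)
        (ring₉ b (+ a ℤ.* (b ℤ.* + x ℤ.+ eval g ρ))))
  cancel-eval x ρ (-[1+ a ] ∷ f) (b ∷ g) v
    rewrite eval-⊕ (ℤ.+[1+ a ] ⊙ g) (b ⊙ f) ρ | eval-⊙ ℤ.+[1+ a ] g ρ | eval-⊙ b f ρ =
    trans (ring₈′ ℤ.+[1+ a ] b (+ x) (eval f ρ) (eval g ρ))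
      (trans (cong (λ z → ℤ.+[1+ a ] ℤ.* (b ℤ.* + x ℤ.+ eval g ρ) ℤ.+ b ℤ.* z) v)
        (ring₉′ b (ℤ.+[1+ a ] ℤ.* (b ℤ.* + x ℤ.+ eval g ρ))))

  cancel-holds : ∀ {n} x (ρ : Vec ℕ n) p {gs} → Vanishes (x ∷ ρ) p →
                 All (Holds (x ∷ ρ)) gs → All (Holds ρ) (map (cancel p) gs)
  cancel-holds x ρ p v [] = []
  cancel-holds x ρ p v (_∷_ {g} h hs) =
    subst (+ 0 ℤ.≤_) (sym (cancel-eval x ρ p g v))
      (subst (ℤ._≤ + magnitude p ℤ.* eval g (x ∷ ρ)) (ℤ.*-zeroʳ (+ magnitude p))
        (ℤ.*-monoˡ-≤-nonNeg (+ magnitude p) h))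
    ∷ cancel-holds x ρ p v hs

  cancel-vanishes : ∀ {n} x (ρ : Vec ℕ n) p {gs} → Vanishes (x ∷ ρ) p →
                    All (Vanishes (x ∷ ρ)) gs → All (Vanishes ρ) (map (cancel p) gs)
  cancel-vanishes x ρ p v [] = []
  cancel-vanishes x ρ p v (_∷_ {g} h hs) =
    trans (cancel-eval x ρ p g v) (trans (cong (+ magnitude p ℤ.*_) h) (ℤ.*-zeroʳ (+ magnitude p)))
    ∷ cancel-vanishes x ρ p v hs

  pivot-free : ∀ {n} x (ρ : Vec ℕ n) es → pivot es ≡ nothing → All (Vanishes (x ∷ ρ)) es →
               All (Vanishes ρ) (map Vec.tail es)
  pivot-free x ρ [] eq [] = []
  pivot-free x ρ ((+ 0 ∷ f) ∷ es) eq (v ∷ vs) =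
    trans (sym (ring₃ (+ x) (eval f ρ))) v ∷ pivot-free x ρ es eq vs
  pivot-free x ρ ((ℤ.+[1+ _ ] ∷ f) ∷ es) () vs
  pivot-free x ρ ((-[1+ _ ] ∷ f) ∷ es) () vs

  prune-holds : ∀ {n} {ρ : Vec ℕ n} {fs} → All (Holds ρ) fs → All (Holds ρ) (prune fs)
  prune-holds [] = []
  prune-holds (_∷_ {f} h hs) with nonneg f
  ... | true = prune-holds hs
  ... | false = h ∷ prune-holds hs

  contradictory : List (Form 0) → Bool
  contradictory [] = false
  contradictory ((+ _ ∷ []) ∷ fs) = contradictory fs
  contradictory ((-[1+ _ ] ∷ []) ∷ fs) = true

  nonvanishing : List (Form 0) → Bool
  nonvanishing [] = false
  nonvanishing ((+ 0 ∷ []) ∷ fs) = nonvanishing fs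
  nonvanishing (_ ∷ fs) = true

  -- Fourier–Motzkin elimination, with the equations es used for substitution first.
  refute : ∀ n → List (Form n) → List (Form n) → Bool
  refute-by : ∀ n → Maybe (Form (suc n)) → List (Form (suc n)) → List (Form (suc n)) → Bool
  refute zero es fs = contradictory fs ∨ nonvanishing es
  refute (suc n) es fs = refute-by n (pivot es) es fs
  refute-by n (just p) es fs = refute n (map (cancel p) es) (prune (map (cancel p) fs))
  refute-by n nothing es fs = refute n (map Vec.tail es) (prune (eliminate fs))

  contradictory-sound : ∀ fs → contradictory fs ≡ true → All (Holds []) fs → ⊥
  contradictory-sound ((+ _ ∷ []) ∷ fs) eq (_ ∷ hs) = contradictory-sound fs eq hs
  contradictory-sound ((-[1+ _ ] ∷ []) ∷ fs) eq (() ∷ hs)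

  nonvanishing-sound : ∀ es → nonvanishing es ≡ true → All (Vanishes []) es → ⊥
  nonvanishing-sound ((+ 0 ∷ []) ∷ es) eq (_ ∷ vs) = nonvanishing-sound es eq vs
  nonvanishing-sound ((ℤ.+[1+ _ ] ∷ []) ∷ es) eq (() ∷ vs)
  nonvanishing-sound ((-[1+ _ ] ∷ []) ∷ es) eq (() ∷ vs)

  refute-sound : ∀ n es fs ρ → refute n es fs ≡ true → All (Vanishes ρ) es → All (Holds ρ) fs → ⊥
  refute-sound zero es fs [] eq vs hs with contradictory fs in eq′
  ... | true = contradictory-sound fs eq′ hs
  ... | false = nonvanishing-sound es eq vs
  refute-sound (suc n) es fs (x ∷ ρ) eq vs hs with pivot es in eq′
  ... | just p = refute-sound n _ _ ρ eq (cancel-vanishes x ρ p v vs) (prune-holds (cancel-holds x ρ p v hs))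
    where v = pivot-vanishes (x ∷ ρ) vs eq′
  ... | nothing = refute-sound n _ _ ρ eq (pivot-free x ρ es eq′ vs) (prune-holds (eliminate-holds x ρ hs))

  record System (n : ℕ) : Set where
    constructor _⨟_
    field
      equations : List (Form n)
      inequalities : List (Form n)

  Satisfies : ∀ {n} → Vec ℕ n → System n → Set
  Satisfies ρ (es ⨟ fs) = All (Vanishes ρ) es × All (Holds ρ) fs

  assume : ∀ {n} → Atom n → System n → System n
  assume (e :≤ f) (es ⨟ fs) = es ⨟ (difference f e ∷ fs)
  -- Strictness becomes a difference of at least one. Integrality enters here; the elimination
  -- itself is valid over the rationals.
  assume (e :< f) (es ⨟ fs) = es ⨟ (difference f (con 1 :+ e) ∷ fs)
  assume (e :≡ f) (es ⨟ fs) = (difference f e ∷ es) ⨟ fs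

  assume-holds : ∀ {n} (a : Atom n) S ρ → ⟦ a ⟧ₐ ρ → Satisfies ρ S → Satisfies ρ (assume a S)
  assume-holds (e :≤ f) S ρ h (vs , hs) = vs , difference-holds e f ρ h ∷ hs
  assume-holds (e :< f) S ρ h (vs , hs) = vs , difference-holds (con 1 :+ e) f ρ h ∷ hs
  assume-holds (e :≡ f) S ρ h (vs , hs) = difference-vanishes e f ρ h ∷ vs , hs

  inconsistent : ∀ {n} → System n → Bool
  inconsistent (es ⨟ fs) = refute _ es fs

  inconsistent-sound : ∀ {n} (S : System n) ρ → inconsistent S ≡ true → Satisfies ρ S → ⊥
  inconsistent-sound (es ⨟ fs) ρ eq (vs , hs) = refute-sound _ es fs ρ eq vs hs

  -- The goal is negated and joins the hypotheses; a goal that is an equation needs two refutations,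
  -- one for each strict order.
  check : ∀ {n} → System n → Sequent n → Bool
  check S (a ⇒ s) = check (assume a S) s
  check S (⊢ e :≤ f) = inconsistent (assume (f :< e) S)
  check S (⊢ e :< f) = inconsistent (assume (f :≤ e) S)
  check S (⊢ e :≡ f) = inconsistent (assume (f :< e) S) ∧ inconsistent (assume (e :< f) S)
  check S ⊢⊥ = inconsistent S

  check-sound : ∀ {n} S (s : Sequent n) ρ → check S s ≡ true → Satisfies ρ S → ⟦ s ⟧ₛ ρ
  check-sound S (a ⇒ s) ρ eq σ h = check-sound (assume a S) s ρ eq (assume-holds a S ρ h σ)
  check-sound S (⊢ e :≤ f) ρ eq σ = ≮⇒≥ λ f<e → inconsistent-sound _ ρ eq (assume-holds (f :< e) S ρ f<e σ)
  check-sound S (⊢ e :< f) ρ eq σ = ≰⇒> λ f≤e → inconsistent-sound _ ρ eq (assume-holds (f :≤ e) S ρ f≤e σ)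
  check-sound S (⊢ e :≡ f) ρ eq σ
    with inconsistent (assume (f :< e) S) in eq₁ | inconsistent (assume (e :< f) S) in eq₂
  ... | true | true = ≤-antisym
    (≮⇒≥ λ f<e → inconsistent-sound _ ρ eq₁ (assume-holds (f :< e) S ρ f<e σ))
    (≮⇒≥ λ e<f → inconsistent-sound _ ρ eq₂ (assume-holds (e :< f) S ρ e<f σ))
  check-sound S ⊢⊥ ρ eq σ = inconsistent-sound S ρ eq σ

  variables : ∀ n → Vec (Expr n) n
  variables n = Vec.map var (Vec.allFin n)

  abstract
    -- The check runs on formal variables, so one evaluation by `refl` serves all values `ρ`.
    linear : ∀ n (s : N-ary n (Expr n) (Sequent n)) → check ([] ⨟ []) (s $ⁿ variables n) ≡ true →
             (ρ : Vec ℕ n) → ⟦ s $ⁿ variables n ⟧ₛ ρ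
    linear n s eq ρ = check-sound ([] ⨟ []) (s $ⁿ variables n) ρ eq ([] , [])

open Linear using (linear; con; _:+_; _:*_; _:≤_; _:<_; _:≡_; _⇒_; ⊢_; ⊢⊥)

-- Sums of distinct terms

Mono : (ℕ → ℕ) → ℕ → Set
Mono a n = ∀ i j → i < j → j < n → a i < a j

data Sums (a : ℕ → ℕ) : ℕ → ℕ → ℕ → Set where
  none : ∀ {n} → Sums a 0 n 0
  skip : ∀ {h n s} → Sums a h n s → Sums a h (suc n) s
  take : ∀ {h n s} → Sums a h n s → Sums a (suc h) (suc n) (a n + s)

-- P has at most x - c elements; keeping c on the left avoids truncated subtraction.
Cap : (ℕ → Set) → ℕ → ℕ → Set
Cap P c x = ∀ L → Unique L → All P L → length L + c ≤ x

cap-weaken : ∀ {P c x c′ x′} → x + c′ ≤ x′ + c → Cap P c x → Cap P c′ x′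
cap-weaken {c = c} {x} {c′} {x′} h cap L u p =
  linear 5 (λ l c x c′ x′ → l :+ c :≤ x ⇒ x :+ c′ :≤ x′ :+ c ⇒ ⊢ l :+ c′ :≤ x′) refl
    (length L ∷ c ∷ x ∷ c′ ∷ x′ ∷ []) (cap L u p) h

-- Appending `N` to a list of elements of `Q` gives a list of elements of `P`, so each element of
-- `N` costs `Q` one unit of its cap. All later deletions are counted this way.
cap-grow : ∀ {P Q c x} (N : List ℕ) → Unique N → All P N → All (λ s → ¬ Q s) N →
           (∀ s → Q s → P s) → Cap P c x → Cap Q (length N + c) x
cap-grow {P} {Q} {c} {x} N uN pN ¬qN q⊂p cap L uL qL =
  subst (_≤ x) eq (cap (L ++ N) (Unique.++⁺ uL uN disjoint) (All.++⁺ (All.map (q⊂p _) qL) pN))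
  where
  disjoint : ∀ {v} → ¬ (v ∈ L × v ∈ N)
  disjoint (v∈L , v∈N) = All.lookup ¬qN v∈N (All.lookup qL v∈L)
  eq : length (L ++ N) + c ≡ length L + (length N + c)
  eq rewrite length-++ L {N} = +-assoc (length L) (length N) c

cap-map : ∀ {P Q c x} (f : ℕ → ℕ) → (∀ s → Q s → P (f s)) →
          (∀ s t → Q s → Q t → f s ≡ f t → s ≡ t) → Cap P c x → Cap Q c x
cap-map {P} {Q} {c} {x} f q⇒p inj cap L uL qL =
  subst (λ l → l + c ≤ x) (length-map f L)
    (cap (map f L) (unique L uL qL) (All.map⁺ (All.map (q⇒p _) qL)))
  where
  fresh : ∀ {y} ys → Q y → All Q ys → All (y ≢_) ys → All (f y ≢_) (map f ys)
  fresh [] qy [] [] = []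
  fresh (z ∷ ys) qy (qz ∷ qys) (y≢z ∷ y≢ys) = (y≢z ∘ inj _ _ qy qz) ∷ fresh ys qy qys y≢ys
  unique : ∀ ys → Unique ys → All Q ys → Unique (map f ys)
  unique [] [] [] = []
  unique (y ∷ ys) (y∉ys ∷ u) (qy ∷ qys) = fresh ys qy qys y∉ys ∷ unique ys u qys

cap-subset : ∀ {P Q c x} → (∀ s → Q s → P s) → Cap P c x → Cap Q c x
cap-subset q⇒p = cap-map id q⇒p (λ _ _ _ _ → id)

applyUpTo-All : ∀ {P : ℕ → Set} (f : ℕ → ℕ) n → (∀ i → i < n → P (f i)) → All P (applyUpTo f n)
applyUpTo-All f n h = All.applyUpTo⁺₁ f n (h _)

applyUpTo-unique : ∀ f n → Mono f n → Unique (applyUpTo f n)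
applyUpTo-unique f n mono = Unique.applyUpTo⁺₁ f n λ i<j j<n → <⇒≢ (mono _ _ i<j j<n)

Mono-≤ : ∀ {a n m} → m ≤ n → Mono a n → Mono a m
Mono-≤ m≤n mono i j i<j j<m = mono i j i<j (≤-trans j<m m≤n)

Mono-weak : ∀ {a n} → Mono a n → ∀ i j → i ≤ j → j < n → a i ≤ a j
Mono-weak {a} mono i j i≤j j<n with m≤n⇒m<n∨m≡n i≤j
... | inj₁ i<j = <⇒≤ (mono i j i<j j<n)
... | inj₂ refl = ≤-refl

Mono-gap : ∀ {a n} → Mono a n → ∀ i d → i + d < n → a i + d ≤ a (i + d)
Mono-gap {a} mono i zero i<n rewrite +-identityʳ i = ≤-reflexive (+-identityʳ (a i))
Mono-gap {a} mono i (suc d) i<n rewrite +-suc i d | +-suc (a i) d =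
  ≤-trans (s≤s (Mono-gap mono i d (<-trans (n<1+n _) i<n))) (mono (i + d) (suc (i + d)) (n<1+n _) i<n)

-- The interval is shrunk from both ends, dropping a term that sits at just one of them; the terms still
-- fill more than half of it, so eventually there is one at each end.
two-sum : ∀ (c : ℕ → ℕ) n → Mono c n → ∀ lo hi i j → i ≤ j → j < n → lo ≤ c i → c j ≤ hi →
          hi + 2 * i < lo + 2 * j →
          ∃[ p ] ∃[ q ] (i ≤ p × p < q × q ≤ j × c p + c q ≡ lo + hi)
two-sum c n mono lo hi i j i≤j j<n lo≤ ≤hi size = go hi lo i j
    (ends-apart lo hi i j i≤j lo≤ ≤hi size) j<n lo≤ ≤hi size
  where
  Result : ℕ → ℕ → ℕ → ℕ → Set
  Result lo hi i j = ∃[ p ] ∃[ q ] (i ≤ p × p < q × q ≤ j × c p + c q ≡ lo + hi)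
  relax : ∀ {i j i′ j′ s} → (∀ {p q} → i ≤ p × p < q × q ≤ j × c p + c q ≡ s → i′ ≤ p × p < q × q ≤ j′
      × c p + c q ≡ s) →
          ∃[ p ] ∃[ q ] (i ≤ p × p < q × q ≤ j × c p + c q ≡ s) →
          ∃[ p ] ∃[ q ] (i′ ≤ p × p < q × q ≤ j′ × c p + c q ≡ s)
  relax f (p , q , r) = p , q , f r
  ends-apart : ∀ lo hi i j → i ≤ j → lo ≤ c i → c j ≤ hi → hi + 2 * i < lo + 2 * j → i < j
  ends-apart lo hi i j i≤j lo≤ ≤hi size with m≤n⇒m<n∨m≡n i≤j
  ... | inj₁ lt = lt
  ... | inj₂ refl = ⊥-elim (linear 4 (λ lo hi i c → lo :≤ c ⇒ c :≤ hi ⇒ hi :+ 2 :* i :< lo :+ 2 :* i ⇒ ⊢⊥) refl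
                      (lo ∷ hi ∷ i ∷ c i ∷ []) lo≤ ≤hi size)
  go : ∀ hi lo i j → i < j → j < n → lo ≤ c i → c j ≤ hi → hi + 2 * i < lo + 2 * j → Result lo hi i j
  -- Moving both ends inward by one keeps the target `lo + hi`.
  shrink : ∀ hi lo i j → i ≤ j → j < n → suc lo ≤ c i → c j ≤ hi → hi + 2 * i < suc lo + 2 * j →
           Result lo (suc hi) i j
  shrink hi lo i j i≤j j<n lo≤ ≤hi size
    with go hi (suc lo) i j (ends-apart (suc lo) hi i j i≤j lo≤ ≤hi size) j<n lo≤ ≤hi size
  ... | p , q , i≤p , p<q , q≤j , eq = p , q , i≤p , p<q , q≤j , trans eq (sym (+-suc lo hi))
  go zero lo i j i<j j<n lo≤ ≤hi size = contradiction (≤-trans (mono i j i<j j<n) ≤hi) λ ()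
  go (suc hi) lo i (suc j) i<j j<n lo≤ ≤hi size
    with m≤n⇒m<n∨m≡n lo≤ | m≤n⇒m<n∨m≡n ≤hi
  ... | inj₂ ci≡lo | inj₂ cj≡hi = i , suc j , ≤-refl , i<j , ≤-refl , cong₂ _+_ (sym ci≡lo) cj≡hi
  ... | inj₂ ci≡lo | inj₁ (s≤s cj<hi) =
    relax (λ { (i<p , rest) → <⇒≤ i<p , rest })
      (shrink hi lo (suc i) (suc j) i<j j<n
        (subst (_< c (suc i)) (sym ci≡lo) (mono i (suc i) (n<1+n i) (≤-trans (s≤s i<j) j<n))) cj<hi
        -- The dropped term counts 2 and the two shortened ends give 2 back, so the margin is
        -- preserved.
        (linear 4 (λ lo hi i j → con 1 :+ hi :+ 2 :* i :< lo :+ 2 :* (con 1 :+ j) ⇒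
          ⊢ hi :+ 2 :* (con 1 :+ i) :< con 1 :+ lo :+ 2 :* (con 1 :+ j)) refl (lo ∷ hi ∷ i ∷ j ∷ []) size))
  ... | inj₁ lo<ci | inj₂ cj≡hi =
    relax (λ { (i≤p , p<q , q≤j , eq) → i≤p , p<q , ≤-trans q≤j (<⇒≤ (n<1+n j)) , eq })
      (shrink hi lo i j (ℕ.s≤s⁻¹ i<j) (<-trans (n<1+n j) j<n) lo<ci
        (ℕ.s≤s⁻¹ (subst (c j <_) cj≡hi (mono j (suc j) (n<1+n j) j<n)))
        (linear 4 (λ lo hi i j → con 1 :+ hi :+ 2 :* i :< lo :+ 2 :* (con 1 :+ j) ⇒
          ⊢ hi :+ 2 :* i :< con 1 :+ lo :+ 2 :* j) refl (lo ∷ hi ∷ i ∷ j ∷ []) size))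
  ... | inj₁ lo<ci | inj₁ (s≤s cj<hi) =
    shrink hi lo i (suc j) (<⇒≤ i<j) j<n lo<ci cj<hi
      (linear 4 (λ lo hi i j → con 1 :+ hi :+ 2 :* i :< lo :+ 2 :* j ⇒
        ⊢ hi :+ 2 :* i :< con 1 :+ lo :+ 2 :* j) refl (lo ∷ hi ∷ i ∷ suc j ∷ []) size)

Sums-≤ : ∀ {a h n s} → Sums a h n s → h ≤ n
Sums-≤ none = z≤n
Sums-≤ (skip σ) = ≤-trans (Sums-≤ σ) (<⇒≤ (n<1+n _))
Sums-≤ (take σ) = s≤s (Sums-≤ σ)

Sums-extend : ∀ {a h n n′ s} → n ≤ n′ → Sums a h n s → Sums a h n′ s
Sums-extend {n = n} {n′} n≤n′ σ with m≤n⇒m<n∨m≡n n≤n′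
... | inj₂ refl = σ
... | inj₁ (s≤s n≤k) = skip (Sums-extend n≤k σ)

Sums-take : ∀ {a h n s} i → n ≤ i → Sums a h n s → Sums a (suc h) (suc i) (a i + s)
Sums-take i n≤i σ = take (Sums-extend n≤i σ)

bottom : (ℕ → ℕ) → ℕ → ℕ
bottom a zero = 0
bottom a (suc h) = a h + bottom a h

bottom-Sums : ∀ a h → Sums a h h (bottom a h)
bottom-Sums a zero = none
bottom-Sums a (suc h) = take (bottom-Sums a h)

bottom-least : ∀ {a h n s} → Mono a n → Sums a h n s → bottom a h ≤ s
bottom-least mono none = z≤n
bottom-least mono (skip σ) = bottom-least (Mono-≤ (<⇒≤ (n<1+n _)) mono) σ
bottom-least mono (take {h} {n} σ) =
  +-mono-≤ (Mono-weak mono h n (Sums-≤ σ) ≤-refl) (bottom-least (Mono-≤ (<⇒≤ (n<1+n _)) mono) σ)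

-- Affine images and reflection

Affine : (ℕ → ℕ) → ℕ → ℕ → ℕ → (ℕ → ℕ) → Set
Affine a n c d b = ∀ i → i < n → a i ≡ c + d * b i

Affine-Sums : ∀ {a} c d b {h n s} → Affine a n c d b → Sums b h n s → Sums a h n (h * c + d * s)
Affine-Sums {a} c d b aff (none {n}) = subst (Sums a 0 n) (sym (*-zeroʳ d)) none
Affine-Sums c d b aff (skip σ) = skip (Affine-Sums c d b (λ i i<n → aff i (<-trans i<n (n<1+n _))) σ)
Affine-Sums {a} c d b aff (take {h} {n} {s} σ) =
  subst (Sums a (suc h) (suc n)) eq (take (Affine-Sums c d b (λ i i<n → aff i (<-trans i<n (n<1+n _))) σ))
  where
  ring : ∀ c d h x s → (c + d * x) + (h * c + d * s) ≡ (c + h * c) + d * (x + s)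
  ring = solve-∀
  eq : a n + (h * c + d * s) ≡ suc h * c + d * (b n + s)
  eq rewrite aff n (n<1+n n) = ring c d h (b n) s

Affine-Mono : ∀ {a n c d b} → Affine a n c d b → Mono a n → Mono b n
Affine-Mono {a} {n} {c} {d} {b} aff mono i j i<j j<n = *-cancelˡ-< d (b i) (b j)
  (+-cancelˡ-< c _ _ (subst₂ _<_ (aff i (<-trans i<j j<n)) (aff j j<n) (mono i j i<j j<n)))

Affine-Cap : ∀ {a n c d b h k x} → 0 < d → Affine a n c d b → Cap (Sums a h n) k x → Cap (Sums b h n) k x
Affine-Cap {c = c} {suc d} {b} {h} _ aff = cap-map (λ s → h * c + suc d * s) (λ _ → Affine-Sums c (suc d) b aff)
  (λ s t _ _ eq → *-cancelˡ-≡ s t (suc d) (+-cancelˡ-≡ (h * c) _ _ eq))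

-- `Sums` peels indices from the top, but reflection reverses their order; this lemma and the next
-- add an index at the bottom.
Sums-bottom-skip : ∀ {a h n s} → Sums (a ∘ suc) h n s → Sums a h (suc n) s
Sums-bottom-skip none = none
Sums-bottom-skip (skip σ) = skip (Sums-bottom-skip σ)
Sums-bottom-skip (take σ) = take (Sums-bottom-skip σ)

Sums-bottom-take : ∀ {a h n s} → Sums (a ∘ suc) h n s → Sums a (suc h) (suc n) (a 0 + s)
Sums-bottom-take {a} (none {n}) = Sums-extend (s≤s z≤n) (take {n = 0} none)
Sums-bottom-take (skip σ) = skip (Sums-bottom-take σ)
Sums-bottom-take {a} (take {h} {n} {s} σ) = subst (Sums a _ _) (+-exchange (a (suc n)) (a 0) s)
    (take (Sums-bottom-take σ))
  where
  +-exchange : ∀ x y z → x + (y + z) ≡ y + (x + z)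
  +-exchange = solve-∀

-- Replace each chosen `c i` by the term of `a` at the opposite index: every such pair adds up to
-- `M`.
Sums-reflect : ∀ {a c h n s M} → (∀ i j → suc (i + j) ≡ n → c i + a j ≡ M) → Sums c h n s →
               ∃[ s′ ] (s + s′ ≡ h * M × Sums a h n s′)
Sums-reflect opp none = 0 , refl , none
Sums-reflect {a} {c} opp (skip {n = n} σ)
  with Sums-reflect {a ∘ suc} {c} (λ i j eq → opp i (suc j) (cong suc (trans (+-suc i j) eq))) σ
... | s′ , eq , σ′ = s′ , eq , Sums-bottom-skip σ′
Sums-reflect {a} {c} {M = M} opp (take {h} {n} {s} σ)
  with Sums-reflect {a ∘ suc} {c} (λ i j eq → opp i (suc j) (cong suc (trans (+-suc i j) eq))) σ
... | s′ , eq , σ′ = a 0 + s′ ,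
  trans (ring (c n) s (a 0) s′) (cong₂ _+_ (opp n 0 (cong suc (+-identityʳ n))) eq) , Sums-bottom-take σ′
  where
  ring : ∀ x s y s′ → (x + s) + (y + s′) ≡ (x + y) + (s + s′)
  ring = solve-∀

-- The reflected set, again in increasing order and starting at 0. For an increasing `a` and `i ≤ N`
-- the subtractions do not truncate.
reflect : (ℕ → ℕ) → ℕ → ℕ → ℕ
reflect a N i = a N ∸ a (N ∸ i)

reflect-+ : ∀ {a N} → Mono a (suc N) → ∀ i j → i + j ≡ N → reflect a N i + a j ≡ a N
reflect-+ {a} mono i j refl rewrite m+n∸m≡n i j =
  m∸n+n≡m (Mono-weak mono j (i + j) (m≤n+m j i) ≤-refl)

reflect-Mono : ∀ {a N} → Mono a (suc N) → Mono (reflect a N) (suc N)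
reflect-Mono {a} {N} mono i j i<j (s≤s j≤N) = ∸-monoʳ-<
  (mono (N ∸ j) (N ∸ i) (∸-monoʳ-< i<j j≤N) (s≤s (m∸n≤m N i)))
  (Mono-weak mono (N ∸ i) N (m∸n≤m N i) ≤-refl)

-- Sums correspond under `s ↦ h * a N ∸ s`. The complementary sum found by `Sums-reflect` shows that
-- `s` is at most `h * a N`, so this map is injective.
reflect-Cap : ∀ {a N h k x} → Mono a (suc N) → Cap (Sums a h (suc N)) k x → Cap
    (Sums (reflect a N) h (suc N)) k x
reflect-Cap {a} {N} {h} mono = cap-map (λ s → h * a N ∸ s) image injective
  where
  opp : ∀ i j → suc (i + j) ≡ suc N → reflect a N i + a j ≡ a N
  opp i j eq = reflect-+ mono i j (suc-injective eq)
  image : ∀ s → Sums (reflect a N) h (suc N) s → Sums a h (suc N) (h * a N ∸ s)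
  image s σ with Sums-reflect opp σ
  ... | s′ , eq , σ′ = subst (Sums a h (suc N)) (trans (sym (m+n∸m≡n s s′)) (cong (_∸ s) eq)) σ′
  injective : ∀ s t → Sums (reflect a N) h (suc N) s → Sums (reflect a N) h (suc N) t →
              h * a N ∸ s ≡ h * a N ∸ t → s ≡ t
  injective s t σ τ eq with Sums-reflect opp σ | Sums-reflect opp τ
  ... | s′ , eqs , _ | t′ , eqt , _ = ∸-cancelˡ-≡
    (≤-trans (m≤m+n s s′) (≤-reflexive eqs)) (≤-trans (m≤m+n t t′) (≤-reflexive eqt)) eq

-- Two summands

-- The case of two summands, with bounded quantifiers so that membership is decidable.
Pair : (ℕ → ℕ) → ℕ → ℕ → Set
Pair a n s = ∃[ p ] (p < n × ∃[ q ] (q < n × p < q × a p + a q ≡ s))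

Pair? : ∀ a n s → Dec (Pair a n s)
Pair? a n s = Dec.map′
  (λ (p , p<n , q , q<n , r) → p , p<n , q , q<n , r) (λ (p , p<n , q , q<n , r) → p , p<n , q , q<n , r)
  (anyUpTo? (λ p → anyUpTo? (λ q → p <? q ×-dec a p + a q ≟ s) n) n)

pair : ∀ a {n} p q → p < q → q < n → Pair a n (a p + a q)
pair a p q p<q q<n = p , <-trans p<q q<n , q , q<n , p<q , refl

Pair-extend : ∀ a {n n′} → n ≤ n′ → ∀ s → Pair a n s → Pair a n′ s
Pair-extend a n≤n′ s (p , p<n , q , q<n , r) = p , ≤-trans p<n n≤n′ , q , ≤-trans q<n n≤n′ , r

Sums₀ : ∀ {a n s} → Sums a 0 n s → s ≡ 0
Sums₀ none = refl
Sums₀ (skip σ) = Sums₀ σ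

Sums₁ : ∀ {a n s} → Sums a 1 n s → ∃[ p ] (p < n × a p ≡ s)
Sums₁ (skip σ) with Sums₁ σ
... | p , p<n , eq = p , <-trans p<n (n<1+n _) , eq
Sums₁ {a} (take {n = n} σ) rewrite Sums₀ σ = n , n<1+n n , sym (+-identityʳ (a n))

Sums₂⇒Pair : ∀ {a n} s → Sums a 2 n s → Pair a n s
Sums₂⇒Pair {a} s (skip σ) = Pair-extend a (<⇒≤ (n<1+n _)) s (Sums₂⇒Pair s σ)
Sums₂⇒Pair {a} _ (take {n = n} σ) with Sums₁ σ
... | p , p<n , refl rewrite +-comm (a n) (a p) = pair a p n p<n (n<1+n n)

Pair⇒Sums₂ : ∀ {a n} s → Pair a n s → Sums a 2 n s
Pair⇒Sums₂ {a} {n} _ (p , p<n , q , q<n , p<q , refl) =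
  subst (Sums a 2 n) (trans (cong (λ y → a q + y) (+-identityʳ (a p))) (+-comm (a q) (a p)))
    (Sums-extend q<n (Sums-take q p<q (Sums-take p z≤n none)))

Pair-max : ∀ a {m s} → Mono a (2 + m) → Pair a (2 + m) s → s ≤ a m + a (1 + m)
Pair-max a {m} mono (p , p<n , q , q<n@(s≤s q≤) , p<q , refl) =
  +-mono-≤ (Mono-weak mono p m (ℕ.s≤s⁻¹ (≤-trans p<q q≤)) (<-trans (n<1+n m) ≤-refl))
      (Mono-weak mono q (suc m) q≤ ≤-refl)

-- The `ν` sums of the last term with consecutive earlier ones are distinct, and each that is not a
-- sum of earlier terms lowers the cap by one.
cap-top : ∀ {a n c x} → Mono a (suc n) → ∀ j ν → j + ν ≤ n →
          (∀ i → i < ν → ¬ Pair a n (a n + a (j + i))) →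
          Cap (Pair a (suc n)) c x → Cap (Pair a n) (ν + c) x
cap-top {a} {n} {c} {x} mono j ν j+ν≤n new cap =
  subst (λ l → Cap (Pair a n) (l + c) x) (length-applyUpTo top ν)
    (cap-grow (applyUpTo top ν) (applyUpTo-unique top ν top-mono) (applyUpTo-All top ν λ i i<ν → top-pair i i<ν)
      (applyUpTo-All top ν new) (Pair-extend a (<⇒≤ (n<1+n n))) cap)
  where
  top = λ i → a n + a (j + i)
  below : ∀ {i} → i < ν → j + i < n
  below i<ν = ≤-trans (+-monoʳ-< j i<ν) j+ν≤n
  top-mono : Mono top ν
  top-mono i k i<k k<ν = +-monoʳ-< (a n) (mono (j + i) (j + k) (+-monoʳ-< j i<k)
      (<-trans (below k<ν) (n<1+n n)))
  top-pair : ∀ i → i < ν → Pair a (suc n) (top i)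
  top-pair i i<ν = subst (Pair a (suc n)) (+-comm (a (j + i)) (a n)) (pair a (j + i) n (below i<ν) (n<1+n n))

beyond-max : ∀ a {m s} → Mono a (2 + m) → a m + a (1 + m) < s → ¬ Pair a (2 + m) s
beyond-max a mono max<s π = <-irrefl refl (≤-trans max<s (Pair-max a mono π))

-- The last term plus either of its two predecessors exceeds the greatest earlier sum, so two sums
-- are always lost.
cap-top-two : ∀ {a m c x} → Mono a (3 + m) → Cap (Pair a (3 + m)) c x → Cap (Pair a (2 + m)) (2 + c) x
cap-top-two {a} {m} mono = cap-top mono m 2 (≤-reflexive (+-comm m 2)) new
  where
  new : ∀ i → i < 2 → ¬ Pair a (2 + m) (a (2 + m) + a (m + i))
  new i i<2 = beyond-max a (Mono-≤ (<⇒≤ (n<1+n _)) mono)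
    (linear 4 (λ x y z t → y :< z ⇒ x :≤ t ⇒ ⊢ x :+ y :< z :+ t) refl
      (a m ∷ a (1 + m) ∷ a (2 + m) ∷ a (m + i) ∷ [])
      (mono (1 + m) (2 + m) (n<1+n _) (n<1+n _))
      (Mono-weak mono m (m + i) (m≤m+n m i)
        (linear 2 (λ m i → i :< con 2 ⇒ ⊢ m :+ i :< con 3 :+ m) refl (m ∷ i ∷ []) i<2)))

-- The minimum 2 n - 3 for n terms: one sum from the first two terms, then two new sums per further
-- term.
pair-lower : ∀ {a} m {c x} → Mono a (2 + m) → Cap (Pair a (2 + m)) c x → 2 * (2 + m) + c ≤ 3 + x
pair-lower {a} zero mono cap = s≤s (s≤s (s≤s (cap (_ ∷ []) ([] ∷ [])
    (pair a 0 1 (s≤s z≤n) (s≤s (s≤s z≤n)) ∷ []))))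
pair-lower (suc m) {c} {x} mono cap =
  linear 3 (λ m c x → 2 :* (con 2 :+ m) :+ (con 2 :+ c) :≤ con 3 :+ x ⇒ ⊢ 2 :*
      (con 3 :+ m) :+ c :≤ con 3 :+ x) refl
    (m ∷ c ∷ x ∷ []) (pair-lower m (Mono-≤ (<⇒≤ (n<1+n _)) mono) (cap-top-two mono cap))

locate : ∀ (b : ℕ → ℕ) x k → b 0 ≤ x → x < b k → ∃[ i ] (i < k × b i ≤ x × x < b (suc i))
locate b x zero b₀≤x x<b₀ = contradiction (≤-trans x<b₀ b₀≤x) (<-irrefl refl)
locate b x (suc k) b₀≤x x<b with b k ≤? x
... | yes bk≤x = k , n<1+n k , bk≤x , x<b
... | no bk≰x with locate b x k b₀≤x (≰⇒> bk≰x)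
...   | i , i<k , r = i , <-trans i<k (n<1+n k) , r

-- b and x - b, taken modulo the largest term b k, are too long to be disjoint.
pair-mod : ∀ b k → Mono b (suc k) → b 0 ≡ 0 → b k + 3 ≤ 2 * k → ∀ x → 0 < x → x < b k →
           Pair b (suc k) x ⊎ Pair b (suc k) (b k + x)
pair-mod b k mono b₀≡0 short x 0<x x<ℓ
  with locate b x k (≤-trans (≤-reflexive b₀≡0) z≤n) x<ℓ
... | i , i<k , bi≤x , x<b with m≤n⇒m<n∨m≡n bi≤x
pair-mod b k mono b₀≡0 short x 0<x x<ℓ | zero , i<k , bi≤x , x<b | inj₂ bi≡x =
  contradiction (trans (sym bi≡x) b₀≡0) (λ x≡0 → <-irrefl (sym x≡0) 0<x)
pair-mod b k mono b₀≡0 short x 0<x x<ℓ | suc i , i<k , bi≤x , x<b | inj₂ bi≡x =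
  inj₁ (subst (Pair b (suc k)) (trans (cong (_+ b (suc i)) b₀≡0) bi≡x)
      (pair b 0 (suc i) (s≤s z≤n) (<-trans i<k (n<1+n k))))
-- Now `x` lies strictly between two terms. Either the terms up to `b i` fill more than half of
-- `[0, x]` and give the sum `x`, or, as `b k` is short, those from `b (suc i)` on fill more than
-- half of `[x, b k]` and give `b k + x`.
... | inj₁ bi<x with x <? 2 * i
...   | yes x<2i = inj₁ (low (two-sum b (suc k) mono 0 x 0 i z≤n (<-trans i<k (n<1+n k)) z≤n bi≤x
                            (subst (_< 2 * i) (sym (+-identityʳ x)) x<2i)))
  where
  low : ∃[ p ] ∃[ q ] (0 ≤ p × p < q × q ≤ i × b p + b q ≡ x) → Pair b (suc k) x
  low (p , q , _ , p<q , q≤i , eq) = subst (Pair b (suc k)) eq (pair b p q p<q (s≤s (≤-trans q≤i (<⇒≤ i<k))))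
...   | no x≮2i = inj₂ (high (two-sum b (suc k) mono x (b k) (suc i) k i<k (n<1+n k) (<⇒≤ x<b) ≤-refl
        (linear 4 (λ x i k l → 2 :* i :≤ x ⇒ l :+ con 3 :≤ 2 :* k ⇒ ⊢ l :+ 2 :* (con 1 :+ i) :< x :+ 2 :* k)
          refl
          (x ∷ i ∷ k ∷ b k ∷ []) (≮⇒≥ x≮2i) short)))
  where
  high : ∃[ p ] ∃[ q ] (suc i ≤ p × p < q × q ≤ k × b p + b q ≡ x + b k) → Pair b (suc k) (b k + x)
  high (p , q , _ , p<q , q≤k , eq) = subst (Pair b (suc k)) (trans eq (+-comm x (b k)))
      (pair b p q p<q (s≤s q≤k))

-- Each nonzero residue modulo `b k` contributes a sum by `pair-mod`, and the `k` sums `b k + b i`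
-- are further ones: `b k + k - 1` in all.
pair-count : ∀ b k {c x} → Mono b (suc k) → b 0 ≡ 0 → b k + 3 ≤ 2 * k →
             Cap (Pair b (suc k)) c x → b k + k + c ≤ 1 + x
pair-count b k {c} {x} mono b₀≡0 short cap = conclude (b k) refl
  where
  ℓ = b k
  -- The smaller representative is preferred. Since `b i` with `i > 0` is itself the sum
  -- `b 0 + b i`, its residue never selects `ℓ + b i`, which remains available for the second
  -- family.
  residue : ℕ → ℕ
  residue y with Pair? b (suc k) y
  ... | yes _ = y
  ... | no _ = ℓ + y
  residue-pair : ∀ y → 0 < y → y < ℓ → Pair b (suc k) (residue y)
  residue-pair y 0<y y<ℓ with Pair? b (suc k) y
  ... | yes π = π
  ... | no ¬π with pair-mod b k mono b₀≡0 short y 0<y y<ℓ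
  ...   | inj₁ π = contradiction π ¬π
  ...   | inj₂ π = π
  residue-injective : ∀ y z → y < z → z < ℓ → residue y ≢ residue z
  residue-injective y z y<z z<ℓ eq with Pair? b (suc k) y | Pair? b (suc k) z
  ... | yes _ | yes _ = <-irrefl eq y<z
  ... | yes _ | no _ = <-irrefl refl (≤-trans (<-trans y<z z<ℓ) (≤-trans (m≤m+n ℓ z) (≤-reflexive (sym eq))))
  ... | no _ | yes _ = <-irrefl refl (≤-trans z<ℓ (≤-trans (m≤m+n ℓ y) (≤-reflexive eq)))
  ... | no _ | no _ = <-irrefl (+-cancelˡ-≡ ℓ y z eq) y<z
  residue-fresh : ∀ y i → 0 < y → y < ℓ → i < k → residue y ≢ ℓ + b i
  residue-fresh y i 0<y y<ℓ i<k eq with Pair? b (suc k) y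
  ... | yes _ = <-irrefl refl (≤-trans y<ℓ (≤-trans (m≤m+n ℓ (b i)) (≤-reflexive (sym eq))))
  residue-fresh y zero 0<y y<ℓ i<k eq | no ¬π =
    <-irrefl (trans (sym b₀≡0) (sym (+-cancelˡ-≡ ℓ y (b 0) eq))) 0<y
  residue-fresh y (suc i) 0<y y<ℓ i<k eq | no ¬π =
    ¬π (subst (Pair b (suc k)) (trans (cong (_+ b (suc i)) b₀≡0) (sym (+-cancelˡ-≡ ℓ y _ eq)))
          (pair b 0 (suc i) (s≤s z≤n) (<-trans i<k (n<1+n k))))
  upper : ℕ → ℕ
  upper i = ℓ + b i
  conclude : ∀ l → l ≡ ℓ → ℓ + k + c ≤ 1 + x
  conclude zero 0≡ℓ =
    ⊥-elim (linear 3 (λ k l z → k :+ z :≤ l ⇒ con 0 :≡ l ⇒ l :+ con 3 :≤ 2 :* k ⇒ ⊢⊥) refl (k ∷ ℓ ∷ b 0 ∷ [])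
      (subst (_≤ ℓ) (+-comm (b 0) k) (Mono-gap mono 0 k ≤-refl)) 0≡ℓ short)
  -- There are `l = ℓ - 1` nonzero residues, listed as `suc i` with `i < l`.
  conclude (suc l) l≡ℓ = subst (λ y → y + k + c ≤ 1 + x) l≡ℓ (s≤s (subst (_≤ x) size (cap (lows ++ highs)
    (Unique.++⁺ lows-unique (applyUpTo-unique upper k upper-mono) disjoint)
    (All.++⁺ (applyUpTo-All low l λ i i<l → residue-pair (suc i) (s≤s z≤n) (<ℓ i<l))
             (applyUpTo-All upper k upper-pair)))))
    where
    low = residue ∘ suc
    lows = applyUpTo low l
    highs = applyUpTo upper k
    <ℓ : ∀ {i} → i < l → suc i < ℓ
    <ℓ i<l = ≤-trans (s≤s i<l) (≤-reflexive l≡ℓ)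
    size : length (lows ++ highs) + c ≡ l + k + c
    size rewrite length-++ lows {highs} | length-applyUpTo low l | length-applyUpTo upper k = refl
    lows-unique : Unique lows
    lows-unique = Unique.applyUpTo⁺₁ low l λ {i} {j} i<j j<l → residue-injective (suc i) (suc j) (s≤s i<j)
        (<ℓ j<l)
    upper-mono : Mono upper k
    upper-mono i j i<j j<k = +-monoʳ-< ℓ (mono i j i<j (<-trans j<k (n<1+n k)))
    upper-pair : ∀ i → i < k → Pair b (suc k) (upper i)
    upper-pair i i<k = subst (Pair b (suc k)) (+-comm (b i) ℓ) (pair b i k i<k (n<1+n k))
    disjoint : ∀ {v} → ¬ (v ∈ lows × v ∈ highs)
    disjoint (v∈lows , v∈highs) with ∈-applyUpTo⁻ low v∈lows | ∈-applyUpTo⁻ upper v∈highs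
    ... | i , i<l , refl | j , j<k , eq = residue-fresh (suc i) j (s≤s z≤n) (<ℓ i<l) j<k eq

-- At most w - 1 pair sums more than the minimum 2 n - 3.
Small : (ℕ → ℕ) → ℕ → ℕ → Set
Small a n w = Cap (Pair a n) 4 (2 * n + w)

Congruent : (ℕ → ℕ) → ℕ → ℕ → Set
Congruent a n d = ∀ i → i < n → ∃[ q ] a i ≡ a 0 + d * q

-- The elements lie in an arithmetic progression of n + w - 1 terms.
Structured : (ℕ → ℕ) → ℕ → ℕ → Set
Structured a n w = ∃[ d ] (∀ i → i < n → ∃[ q ] (a i ≡ a 0 + d * q × q + 2 ≤ n + w))

Structured⇒Congruent : ∀ {a n w} ((d , _) : Structured a n w) → Congruent a n d
Structured⇒Congruent (d , st) i i<n with st i i<n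
... | q , eq , _ = q , eq

Structured-weaken : ∀ {a n w} → Structured a n w → Structured a n (suc w)
Structured-weaken {a} {n} {w} (d , st) = d , λ i i<n → weaken (st i i<n)
  where
  weaken : ∀ {x} → ∃[ q ] (x ≡ a 0 + d * q × q + 2 ≤ n + w) → ∃[ q ] (x ≡ a 0 + d * q × q + 2 ≤ n + suc w)
  weaken (q , eq , le) = q , eq , ≤-trans le (+-monoʳ-≤ n (<⇒≤ (n<1+n w)))

-- Extending a progression by a larger term

factor : ∀ {d m} → d ∣ m → ∃[ q ] m ≡ d * q
factor {d} (divides q eq) = q , trans eq (*-comm q d)

choose : ∀ {n} {R : ℕ → ℕ → Set} → (∀ i → i < n → ∃ (R i)) → ∃[ b ] (∀ i → i < n → R i (b i))
choose {n} {R} f = b , spec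
  where
  b : ℕ → ℕ
  b i with i <? n
  ... | yes i<n = proj₁ (f i i<n)
  -- Outside the range the value is arbitrary.
  ... | no _ = 0
  spec : ∀ i → i < n → R i (b i)
  spec i i<n with i <? n
  ... | yes i<n′ = proj₂ (f i i<n′)
  ... | no i≮n = contradiction i<n i≮n

0<scale : ∀ {a m} d → Mono a (2 + m) → Congruent a (2 + m) d → 0 < d
0<scale (suc _) mono cong′ = s≤s z≤n
0<scale {a} zero mono cong′ with cong′ 1 (s≤s (s≤s z≤n))
... | q , eq = contradiction (mono 0 1 (s≤s z≤n) (s≤s (s≤s z≤n)))
                 (<-irrefl (sym (trans eq (+-identityʳ (a 0)))))

scale-cancel : ∀ x d → 0 < d → ∀ q r → x + d * q ≡ x + d * r → q ≡ r
scale-cancel x (suc d) _ q r eq = *-cancelˡ-≡ q r (suc d) (+-cancelˡ-≡ x _ _ eq)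

normalise : ∀ {a m} d → Mono a (2 + m) → Congruent a (2 + m) d →
            ∃[ b ] (Affine a (2 + m) (a 0) d b × Mono b (2 + m) × b 0 ≡ 0)
normalise {a} {m} d mono cong′ with choose {R = λ i q → a i ≡ a 0 + d * q} cong′
... | b , aff = b , aff , Affine-Mono {c = a 0} {d} {b} aff mono ,
  scale-cancel (a 0) d (0<scale d mono cong′) (b 0) 0
    (trans (sym (aff 0 (s≤s z≤n))) (sym (trans (cong (λ y → a 0 + y) (*-zeroʳ d)) (+-identityʳ (a 0)))))

Affine-Cap-Pair : ∀ {a n} c d b {k x} → 0 < d → Affine a n c d b → Cap (Pair a n) k x → Cap (Pair b n) k x
Affine-Cap-Pair c d b 0<d aff cap = cap-subset Pair⇒Sums₂
    (Affine-Cap {c = c} {d} {b} 0<d aff (cap-subset Sums₂⇒Pair cap))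

-- If the whole sequence is short enough for `pair-count`, that count gives the bound. Otherwise the
-- last term is so far away that most of its sums are new, and `pair-count` for the remaining terms
-- leaves no room for them.
append-bound : ∀ b k {w} → Mono b (2 + k) → b 0 ≡ 0 → 2 * w ≤ k → w + 2 ≤ k → b k + 1 ≤ k + w →
               Small b (2 + k) w → b (suc k) ≤ k + w
append-bound b zero {w} _ _ _ w+2≤0 = contradiction (subst (_≤ 0) (+-comm w 2) w+2≤0) λ ()
append-bound b k@(suc k′) {w} mono b₀≡0 2w≤k w+2≤k bk≤ small with b (suc k) + 3 ≤? 2 * suc k
... | yes short = linear 3 (λ x k w → x :+ (con 1 :+ k) :+ con 4 :≤ con 1 :+ (2 :* (con 2 :+ k) :+ w) ⇒
    ⊢ x :≤ k :+ w) refl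
        (b (suc k) ∷ k ∷ w ∷ []) (pair-count b (suc k) mono b₀≡0 short small)
... | no long = ⊥-elim (linear 5 (λ x e ν k w →
          x :+ k :+ (ν :+ con 4) :≤ con 1 :+ (2 :* (con 2 :+ k) :+ w) ⇒ k :+ e :≡ x ⇒
              2 :* e :+ ν :≡ con 1 :+ k ⇒
          x :+ con 1 :≤ k :+ w ⇒ 2 :* w :≤ k ⇒ ⊢⊥) refl
        (b k ∷ e ∷ ν ∷ k ∷ w ∷ []) (pair-count b k mono′ b₀≡0 short cap) excess rest bk≤ 2w≤k)
  where
  mono′ : Mono b (suc k)
  mono′ = Mono-≤ (<⇒≤ (n<1+n _)) mono
  index≤ : ∀ i → i < 2 + k → i ≤ b i
  index≤ i i< = subst (λ y → y + i ≤ b i) b₀≡0 (Mono-gap mono 0 i i<)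
  -- The number of integers missing from `[0, b k]` among the first `k + 1` terms.
  e = b k ∸ k
  excess : k + e ≡ b k
  excess = m+[n∸m]≡n (index≤ k (<-trans (n<1+n k) (n<1+n (suc k))))
  ν = suc k ∸ 2 * e
  rest : 2 * e + ν ≡ suc k
  rest = m+[n∸m]≡n (linear 4 (λ x e k w → k :+ e :≡ x ⇒ x :+ con 1 :≤ k :+ w ⇒ 2 :* w :≤ k ⇒
      ⊢ 2 :* e :≤ con 1 :+ k) refl
    (b k ∷ e ∷ k ∷ w ∷ []) excess bk≤ 2w≤k)
  short : b k + 3 ≤ 2 * k
  short = linear 3 (λ x k w → x :+ con 1 :≤ k :+ w ⇒ w :+ con 2 :≤ k ⇒ ⊢ x :+ con 3 :≤ 2 :* k) refl
    (b k ∷ k ∷ w ∷ []) bk≤ w+2≤k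
  -- Earlier sums are below `2 * (k + e)`, while the last term is at least `2 * k` and
  -- `b (2 * e + i)` at least `2 * e`.
  new : ∀ i → i < ν → ¬ Pair b (suc k) (b (suc k) + b (2 * e + i))
  new i i<ν = beyond-max b mono′ (linear 7 (λ x y z t e k i → x :< y ⇒ k :+ e :≡ y ⇒
      2 :* (con 1 :+ k) :< z :+ con 3 ⇒ 2 :* e :+ i :≤ t ⇒ ⊢ x :+ y :< z :+ t)
    refl (b k′ ∷ b k ∷ b (suc k) ∷ b (2 * e + i) ∷ e ∷ k ∷ i ∷ [])
    (mono k′ k (n<1+n k′) (<-trans (n<1+n k) (n<1+n (suc k)))) excess (≰⇒> long)
    (index≤ (2 * e + i) (<-trans (subst (2 * e + i <_) rest (+-monoʳ-< (2 * e) i<ν)) (n<1+n (suc k)))))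
  cap : Cap (Pair b (suc k)) (ν + 4) (2 * (2 + k) + w)
  cap = cap-top mono (2 * e) ν (≤-reflexive rest) new small

-- All earlier sums agree modulo `d`, and no sum with the last term agrees with them. So all `k + 1`
-- of those sums are new, on top of the minimum for the rest.
incongruent-large : ∀ {a k d w} → Mono a (2 + k) → w + 2 ≤ k → Congruent a (suc k) d →
                    ¬ (∃[ q ] a (suc k) ≡ a 0 + d * q) → ¬ Small a (2 + k) w
incongruent-large {k = zero} {w = w} mono w+2≤0 = contradiction (subst (_≤ 0) (+-comm w 2) w+2≤0) λ ()
incongruent-large {a} {k@(suc k′)} {d} {w} mono w+2≤k cong′ ¬cong small =
  linear 2 (λ k w → 2 :* (con 1 :+ k) :+ ((con 1 :+ k) :+ con 4) :≤ con 3 :+ (2 :* (con 2 :+ k) :+ w) ⇒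
      w :+ con 2 :≤ k ⇒ ⊢⊥) refl
    (k ∷ w ∷ []) (pair-lower k′ (Mono-≤ (<⇒≤ (n<1+n _)) mono) (cap-top mono 0 (suc k) ≤-refl new small)) w+2≤k
  where
  δ = a (suc k) ∸ a 0
  a₀+δ : a 0 + δ ≡ a (suc k)
  a₀+δ = m+[n∸m]≡n (Mono-weak mono 0 (suc k) z≤n ≤-refl)
  expand : ∀ d c x y → (c + d * x) + (c + d * y) ≡ (c + c) + d * (x + y)
  expand = solve-∀
  collect : ∀ d c δ z → (c + δ) + (c + d * z) ≡ (c + c) + (δ + d * z)
  collect = solve-∀
  new : ∀ i → i < suc k → ¬ Pair a (suc k) (a (suc k) + a i)
  new i i<n (p , p<n , q , q<n , p<q , eq) with cong′ p p<n | cong′ q q<n | cong′ i i<n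
  ... | x , ap | y , aq | z , ai = ¬cong (proj₁ (factor d∣δ) , trans (sym a₀+δ)
      (cong (λ v → a 0 + v) (proj₂ (factor d∣δ))))
    where
    sums : d * (x + y) ≡ δ + d * z
    sums = +-cancelˡ-≡ (a 0 + a 0) _ _ (trans (sym (expand d (a 0) x y))
      (trans (cong₂ _+_ (sym ap) (sym aq)) (trans eq (trans (cong₂ _+_ (sym a₀+δ) ai) (collect d (a 0) δ z)))))
    d∣δ : d ∣ δ
    d∣δ = ∣m+n∣m⇒∣n (subst (d ∣_) (trans sums (+-comm δ (d * z))) (m∣m*n (x + y))) (m∣m*n z)

-- The difference `d` of the shorter progression is kept: `incongruent-large` makes the last term
-- congruent, and `append-bound`, applied after dividing by `d`, bounds its position.
append : ∀ {a k w} → Mono a (2 + k) → 2 * w ≤ k → w + 2 ≤ k → Structured a (suc k) w →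
         Small a (2 + k) w → Structured a (2 + k) w
append {k = zero} {w} mono 2w≤0 w+2≤0 = contradiction (subst (_≤ 0) (+-comm w 2) w+2≤0) λ ()
append {a} {k@(suc k′)} {w} mono 2w≤k w+2≤k st@(d , elems) small with d ∣? (a (suc k) ∸ a 0)
... | no d∤δ = contradiction small (incongruent-large {d = d} mono w+2≤k
    (Structured⇒Congruent {w = w} st) λ (q , eq) →
        d∤δ (subst (d ∣_) (sym (trans (cong (_∸ a 0) eq) (m+n∸m≡n (a 0) (d * q)))) (m∣m*n q)))
... | yes (divides q eq) = d , λ i i<n → b i , aff i i<n , bound i i<n
  where
  cong′ : Congruent a (2 + k) d
  cong′ i (s≤s i≤) with m≤n⇒m<n∨m≡n i≤
  ... | inj₁ i<n = Structured⇒Congruent {w = w} st i i<n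
  ... | inj₂ refl = q , trans (sym (m+[n∸m]≡n (Mono-weak mono 0 (suc k) z≤n ≤-refl)))
                         (cong (λ v → a 0 + v) (trans eq (*-comm q d)))
  0<d = 0<scale d mono cong′
  normal = normalise d mono cong′
  b = proj₁ normal
  aff = proj₁ (proj₂ normal)
  b-mono = proj₁ (proj₂ (proj₂ normal))
  bk≤ : b k + 1 ≤ k + w
  bk≤ with elems k (n<1+n k)
  ... | r , ak , r+2≤ = linear 4 (λ x r k w → x :≡ r ⇒ r :+ con 2 :≤ con 1 :+ k :+ w ⇒ ⊢ x :+ con 1 :≤ k :+ w)
      refl
    (b k ∷ r ∷ k ∷ w ∷ []) (scale-cancel (a 0) d 0<d (b k) r
      (trans (sym (aff k (<-trans (n<1+n k) (n<1+n (suc k))))) ak)) r+2≤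
  last : b (suc k) ≤ k + w
  last = append-bound b k b-mono (proj₂ (proj₂ (proj₂ normal))) 2w≤k w+2≤k bk≤
      (Affine-Cap-Pair (a 0) d b 0<d aff small)
  bound : ∀ i → i < 2 + k → b i + 2 ≤ 2 + k + w
  bound i i<n = linear 4 (λ x y k w → x :≤ y ⇒ y :≤ k :+ w ⇒ ⊢ x :+ con 2 :≤ con 2 :+ k :+ w) refl
    (b i ∷ b (suc k) ∷ k ∷ w ∷ []) (Mono-weak b-mono i (suc k) (ℕ.s≤s⁻¹ i<n) ≤-refl) last

-- Deleting the largest element a (2 + m) removes only its sums with the two next largest.
Stable : (ℕ → ℕ) → ℕ → Set
Stable a m = ∀ j → j < m → Pair a (2 + m) (a (2 + m) + a j)

-- At least two sums disappear, and the minimum falls by exactly two.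
Small-shrink : ∀ {a m w} → Mono a (3 + m) → Small a (3 + m) w → Small a (2 + m) w
Small-shrink {m = m} {w} mono small = cap-weaken
  (linear 2 (λ m w → ⊢ 2 :* (con 3 :+ m) :+ w :+ con 4 :≤ 2 :* (con 2 :+ m) :+ w :+ con 6) refl (m ∷ w ∷ []))
  (cap-top-two mono small)

-- One lost sum beyond the two forced ones lowers the excess; if there is none, the deletion is
-- stable.
Small-drop : ∀ {a m w} → Mono a (3 + m) → Small a (3 + m) (suc w) → Stable a m ⊎ Small a (2 + m) w
Small-drop {a} {m} {w} mono small
  with anyUpTo? (λ j → ¬? (Pair? a (2 + m) (a (2 + m) + a j))) m
... | no none-new = inj₁ λ j j<m → decidable-stable (Pair? a (2 + m) (a (2 + m) + a j)) λ ¬π →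
    none-new (j , j<m , ¬π)
... | yes (j , j<m , ¬π) = inj₂ (cap-weaken
        (linear 2 (λ m w → ⊢ 2 :* (con 3 :+ m) :+ (con 1 :+ w) :+ con 4 :≤ 2 :* (con 2 :+ m) :+ w :+ con 7)
          refl (m ∷ w ∷ []))
        (cap-grow (top j ∷ top m ∷ top (1 + m) ∷ [])
          ((<⇒≢ j<m′ ∷ <⇒≢ (<-trans j<m′ m<m+1) ∷ []) ∷ (<⇒≢ m<m+1 ∷ []) ∷ [] ∷ [])
          (top-pair j (<-trans j<m (<-trans (n<1+n m) (n<1+n (1 + m))))
            ∷ top-pair m (<-trans (n<1+n m) (n<1+n (1 + m))) ∷ top-pair (1 + m) (n<1+n (1 + m)) ∷ [])
          (¬π ∷ new m ≤-refl (<⇒≤ (s≤s (n≤1+n _))) ∷ new (1 + m) (n≤1+n m) (n≤1+n _) ∷ [])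
          (Pair-extend a (<⇒≤ (n<1+n _))) small))
  where
  top : ℕ → ℕ
  top i = a (2 + m) + a i
  top-mono : ∀ {i k} → i < k → k < 2 + m → top i < top k
  top-mono i<k k<n = +-monoʳ-< (a (2 + m)) (mono _ _ i<k (<-trans k<n (n<1+n _)))
  j<m′ = top-mono j<m (<-trans (n<1+n m) (n<1+n (1 + m)))
  m<m+1 = top-mono (n<1+n m) (n<1+n (1 + m))
  top-pair : ∀ i → i < 2 + m → Pair a (3 + m) (top i)
  top-pair i i<n = subst (Pair a (3 + m)) (+-comm (a i) (a (2 + m))) (pair a i (2 + m) i<n (n<1+n _))
  new : ∀ i → m ≤ i → i < 3 + m → ¬ Pair a (2 + m) (top i)
  new i m≤i i<n = beyond-max a (Mono-≤ (<⇒≤ (n<1+n _)) mono)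
    (linear 4 (λ x y z t → x :≤ t ⇒ y :< z ⇒ ⊢ x :+ y :< z :+ t) refl (a m ∷ a (1 + m) ∷ a (2 + m) ∷ a i ∷ [])
      (Mono-weak mono m i m≤i i<n) (mono (1 + m) (2 + m) (n<1+n _) (n<1+n _)))

-- The left side exceeds every sum of two earlier terms other than the largest one, so it must equal
-- that one.
Stable-first : ∀ {a t} → Mono a (4 + t) → Stable a (1 + t) → a (3 + t) + a t ≡ a (2 + t) + a (1 + t)
Stable-first {a} {t} mono stable with stable t (n<1+n t)
... | p , p<n , q , q<n , p<q , eq = solve (m≤n⇒m<n∨m≡n (ℕ.s≤s⁻¹ q<n)) (m≤n⇒m<n∨m≡n (ℕ.s≤s⁻¹ p<q′))
  where
  p<q′ : p < 2 + t
  p<q′ = ≤-trans p<q (ℕ.s≤s⁻¹ q<n)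
  step : ∀ i → suc i < 4 + t → a i < a (suc i)
  step i i<n = mono i (suc i) (n<1+n i) i<n
  weak : ∀ i j → i ≤ j → j < 4 + t → a i ≤ a j
  weak = Mono-weak mono
  solve : q < 2 + t ⊎ q ≡ 2 + t → p < 1 + t ⊎ p ≡ 1 + t → a (3 + t) + a t ≡ a (2 + t) + a (1 + t)
  solve (inj₂ refl) (inj₂ refl) = trans (sym eq) (+-comm (a (1 + t)) (a (2 + t)))
  solve (inj₂ refl) (inj₁ (s≤s p≤t)) =
    ⊥-elim (linear 4 (λ p x y z → p :≤ x ⇒ y :< z ⇒ p :+ y :≡ z :+ x ⇒ ⊢⊥) refl
        (a p ∷ a t ∷ a (2 + t) ∷ a (3 + t) ∷ [])
      (weak p t p≤t (s≤s (m≤n+m t 3))) (step (2 + t) ≤-refl) eq)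
  solve (inj₁ (s≤s q≤)) _ =
    ⊥-elim (linear 6 (λ p q x y z u → p :≤ x ⇒ q :≤ y ⇒ y :< z ⇒ z :< u ⇒ p :+ q :≡ u :+ x ⇒ ⊢⊥) refl
      (a p ∷ a q ∷ a t ∷ a (1 + t) ∷ a (2 + t) ∷ a (3 + t) ∷ [])
      (weak p t (ℕ.s≤s⁻¹ (≤-trans p<q q≤)) (s≤s (m≤n+m t 3)))
      (weak q (1 + t) q≤ (s≤s (s≤s (m≤n+m t 2)))) (step (1 + t) (n≤1+n _)) (step (2 + t) ≤-refl) eq)

-- The largest earlier sum is too big by the first equation, and `a (2 + t) + a (1 + t)` too small
-- by the second; only `a (3 + t) + a (1 + t)` is left among the sums large enough.
Stable-second : ∀ {a t} → Mono a (5 + t) → Stable a (2 + t) →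
                a (4 + t) + a (1 + t) ≡ a (3 + t) + a (2 + t) → a (3 + t) + a t ≡ a (2 + t) + a (1 + t) →
                a (4 + t) + a t ≡ a (3 + t) + a (1 + t)
Stable-second {a} {t} mono stable first first′ with stable t (s≤s (n≤1+n t))
... | p , p<n , q , q<n , p<q , eq = solve (m≤n⇒m<n∨m≡n (ℕ.s≤s⁻¹ q<n)) (m≤n⇒m<n∨m≡n (ℕ.s≤s⁻¹ p<q′))
  where
  p<q′ : p < 3 + t
  p<q′ = ≤-trans p<q (ℕ.s≤s⁻¹ q<n)
  step : ∀ i → suc i < 5 + t → a i < a (suc i)
  step i i<n = mono i (suc i) (n<1+n i) i<n
  step₁ = step t (s≤s (s≤s (m≤n+m t 3)))
  step₂ = step (1 + t) (s≤s (s≤s (s≤s (m≤n+m t 2))))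
  step₃ = step (2 + t) (n≤1+n _)
  step₄ = step (3 + t) ≤-refl
  weak : ∀ {i} j → j < 5 + t → i ≤ j → a i ≤ a j
  weak j j<n i≤j = Mono-weak mono _ j i≤j j<n
  t<n = s≤s (m≤n+m t 4)
  x₀ = a t
  x₁ = a (1 + t)
  x₂ = a (2 + t)
  x₃ = a (3 + t)
  x₄ = a (4 + t)
  solve : q < 3 + t ⊎ q ≡ 3 + t → p < 2 + t ⊎ p ≡ 2 + t → x₄ + x₀ ≡ x₃ + x₁
  solve (inj₂ refl) (inj₂ refl) =
    ⊥-elim (linear 5 (λ x y z u v → x :< y ⇒ v :+ y :≡ u :+ z ⇒ z :+ u :≡ v :+ x ⇒ ⊢⊥) refl
      (x₀ ∷ x₁ ∷ x₂ ∷ x₃ ∷ x₄ ∷ []) step₁ first eq)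
  solve (inj₂ refl) (inj₁ (s≤s p≤)) with m≤n⇒m<n∨m≡n p≤
  ... | inj₂ refl = trans (sym eq) (+-comm x₁ x₃)
  ... | inj₁ (s≤s p≤t) =
    ⊥-elim (linear 4 (λ p x u v → p :≤ x ⇒ u :< v ⇒ p :+ u :≡ v :+ x ⇒ ⊢⊥) refl (a p ∷ x₀ ∷ x₃ ∷ x₄ ∷ [])
      (weak t t<n p≤t) step₄ eq)
  solve (inj₁ (s≤s q≤)) _ with m≤n⇒m<n∨m≡n q≤ | m≤n⇒m<n∨m≡n (ℕ.s≤s⁻¹ (≤-trans p<q q≤))
  ... | inj₂ refl | inj₂ refl =
    ⊥-elim (linear 5 (λ x y z u v → u :< v ⇒ u :+ x :≡ z :+ y ⇒ y :+ z :≡ v :+ x ⇒ ⊢⊥) refl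
      (x₀ ∷ x₁ ∷ x₂ ∷ x₃ ∷ x₄ ∷ []) step₄ first′ eq)
  ... | inj₂ refl | inj₁ (s≤s p≤t) =
    ⊥-elim (linear 5 (λ p x z u v → p :≤ x ⇒ z :< u ⇒ u :< v ⇒ p :+ z :≡ v :+ x ⇒ ⊢⊥) refl
        (a p ∷ x₀ ∷ x₂ ∷ x₃ ∷ x₄ ∷ [])
      (weak t t<n p≤t) step₃ step₄ eq)
  ... | inj₁ (s≤s q≤t+1) | _ =
    ⊥-elim (linear 7 (λ p q x y z u v → p :≤ x ⇒ q :≤ y ⇒ y :< z ⇒ z :< u ⇒ u :< v ⇒ p :+ q :≡ v :+ x ⇒ ⊢⊥) refl
      (a p ∷ a q ∷ x₀ ∷ x₁ ∷ x₂ ∷ x₃ ∷ x₄ ∷ [])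
      (weak t t<n (ℕ.s≤s⁻¹ (≤-trans p<q q≤t+1))) (weak (1 + t)
        (s≤s (s≤s (m≤n+m t 3))) q≤t+1) step₂ step₃ step₄ eq)

top-Congruent : ∀ {a N} d → Mono a (suc N) → (∀ j → j ≤ N → ∃[ c ] a N ≡ a j + d * c) → Congruent a (suc N) d
top-Congruent {a} {N} d mono from-top i (s≤s i≤N) with from-top i i≤N | from-top 0 z≤n
... | x , eqx | y , eqy = proj₁ (factor d∣δ) ,
      trans (sym a₀+δ) (cong (λ v → a 0 + v) (proj₂ (factor d∣δ)))
  where
  δ = a i ∸ a 0
  a₀+δ : a 0 + δ ≡ a i
  a₀+δ = m+[n∸m]≡n (Mono-weak mono 0 i z≤n (s≤s i≤N))
  d∣δ : d ∣ δ
  d∣δ = ∣m+n∣m⇒∣n (subst (d ∣_)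
    (linear 5 (λ a₀ δ ai u v → a₀ :+ δ :≡ ai ⇒ ai :+ u :≡ a₀ :+ v ⇒ ⊢ v :≡ u :+ δ) refl
      (a 0 ∷ δ ∷ a i ∷ d * x ∷ d * y ∷ []) a₀+δ (trans (sym eqx) eqy)) (m∣m*n y)) (m∣m*n x)

-- Distances from the top are multiples of `d`, by descending induction: stability writes
-- `a N + a j` as `a p + a q` with both indices between `j` and `N`, so the distance of `a j` is the
-- sum of those of `a p` and `a q`.
Stable-Congruent : ∀ {a m d} → Mono a (3 + m) → Stable a m →
                   a (1 + m) + d ≡ a (2 + m) → a m + d ≡ a (1 + m) → Congruent a (3 + m) d
Stable-Congruent {a} {m} {d} mono stable eq₁ eq₂ = top-Congruent d mono λ j → from-top (3 + m) j
    (≤-trans (n≤1+n _) (m≤m+n (3 + m) j))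
  where
  N = 2 + m
  d*1 : ∀ x → x + d ≡ x + d * 1
  d*1 x = cong (λ v → x + v) (sym (*-identityʳ d))
  d*2 : ∀ x → (x + d) + d ≡ x + d * 2
  d*2 x = trans (+-assoc x d d) (cong (λ v → x + v)
      (trans (cong (λ v → d + v) (sym (*-identityʳ d))) (sym (*-suc d 1))))
  d*0 : ∀ x → x ≡ x + d * 0
  d*0 x = sym (trans (cong (λ v → x + v) (*-zeroʳ d)) (+-identityʳ x))
  ring : ∀ x y d c e → (x + d * c) + (y + d * e) ≡ (x + y) + d * (c + e)
  ring = solve-∀
  -- The fuel `f` bounds `N - j`, making the descent structural.
  from-top : ∀ f j → N ≤ f + j → j ≤ N → ∃[ c ] a N ≡ a j + d * c
  earlier : ∀ f j → N ≤ suc f + j → j < m → ∃[ c ] a N ≡ a j + d * c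
  from-top zero j N≤j j≤N with ≤-antisym N≤j j≤N
  ... | refl = 0 , d*0 (a N)
  from-top (suc f) j N≤ j≤N with m≤n⇒m<n∨m≡n j≤N
  ... | inj₂ refl = 0 , d*0 (a N)
  ... | inj₁ (s≤s j≤) with m≤n⇒m<n∨m≡n j≤
  ... | inj₂ refl = 1 , trans (sym eq₁) (d*1 (a (1 + m)))
  ... | inj₁ (s≤s j≤m) with m≤n⇒m<n∨m≡n j≤m
  ... | inj₂ refl = 2 , trans (sym eq₁) (trans (cong (_+ d) (sym eq₂)) (d*2 (a m)))
  ... | inj₁ j<m = earlier f j N≤ j<m
  earlier f j N≤ j<m with stable j j<m
  ... | p , p<N , q , q<N , p<q , eq = combine
      (from-top f p (next p j<p) (<⇒≤ p<N)) (from-top f q (next q (<-trans j<p p<q)) (<⇒≤ q<N))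
    where
    next : ∀ i → j < i → N ≤ f + i
    next i j<i = ≤-trans N≤ (≤-trans (≤-reflexive (sym (+-suc f j))) (+-monoʳ-≤ f j<i))
    j<p : j < p
    j<p = ≰⇒> λ p≤j → linear 4 (λ p q j t → p :≤ j ⇒ q :< t ⇒ p :+ q :≡ t :+ j ⇒ ⊢⊥) refl
        (a p ∷ a q ∷ a j ∷ a N ∷ [])
      (Mono-weak mono p j p≤j (<-trans j<m (s≤s (m≤n+m m 2)))) (mono q N q<N ≤-refl) eq
    combine : ∃[ c ] a N ≡ a p + d * c → ∃[ c ] a N ≡ a q + d * c → ∃[ c ] a N ≡ a j + d * c
    combine (c , eqc) (e , eqe) = c + e , +-cancelˡ-≡ (a N) _ _ (trans (cong₂ _+_ eqc eqe)
      (trans (ring (a p) (a q) d c e) (trans (cong (_+ d * (c + e)) eq) (+-assoc (a N) (a j) (d * (c + e))))))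

reflect-Congruent : ∀ {a N} d → Mono a (suc N) → Congruent (reflect a N) (suc N) d → Congruent a (suc N) d
reflect-Congruent {a} {N} d mono cong′ = top-Congruent d mono λ j j≤N → from-top j j≤N
    (cong′ (N ∸ j) (s≤s (m∸n≤m N j)))
  where
  from-top : ∀ j → j ≤ N → ∃[ q ] reflect a N (N ∸ j) ≡ (a N ∸ a N) + d * q → ∃[ c ] a N ≡ a j + d * c
  from-top j j≤N (q , eq) = q , trans (sym (reflect-+ mono (N ∸ j) j (m∸n+n≡m j≤N)))
    (trans (+-comm (reflect a N (N ∸ j)) (a j)) (cong (λ v → a j + v)
      (trans eq (cong (_+ d * q) (n∸n≡0 (a N))))))

-- Inverse theorem for two summands

Inverse₂ : ℕ → ℕ → Set
Inverse₂ n w = ∀ {a} → Mono a n → Small a n w → Structured a n w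

-- Once all differences are divisible by `d`, only the total length has to be bounded.
short-Structured : ∀ {a m} d w → Mono a (2 + m) → Congruent a (2 + m) d →
                   a (1 + m) + d ≤ a 0 + (1 + m + w) * d → Structured a (2 + m) w
short-Structured {a} {m} d w mono cong′ short = d , λ i i<n → q i , aff i i<n , bound i i<n
  where
  0<d = 0<scale d mono cong′
  normal = normalise d mono cong′
  q = proj₁ normal
  aff = proj₁ (proj₂ normal)
  cancel : ∀ d x y → 0 < d → d * x + d ≤ y * d → x + 1 ≤ y
  cancel d@(suc _) x y _ le = *-cancelˡ-≤ d (≤-trans
      (≤-reflexive (trans (*-distribˡ-+ d x 1) (cong (λ v → d * x + v) (*-identityʳ d))))
    (≤-trans le (≤-reflexive (*-comm y d))))
  bound : ∀ i → i < 2 + m → q i + 2 ≤ 2 + m + w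
  bound i i<n = subst (_≤ 2 + m + w) (sym (+-suc (q i) 1)) (s≤s (cancel d (q i) (1 + m + w) 0<d
    (linear 6 (λ ai al a₀ x d y → ai :≤ al ⇒ ai :≡ a₀ :+ x ⇒ al :+ d :≤ a₀ :+ y ⇒ ⊢ x :+ d :≤ y) refl
      (a i ∷ a (1 + m) ∷ a 0 ∷ d * q i ∷ d ∷ (1 + m + w) * d ∷ [])
      (Mono-weak mono i (1 + m) (ℕ.s≤s⁻¹ i<n) ≤-refl) (aff i i<n) short)))

reflect-Structured : ∀ {a m w} → Mono a (2 + m) → Structured (reflect a (1 + m)) (2 + m) w →
                     Structured a (2 + m) w
reflect-Structured {a} {m} {w} mono st@(d , elems) = short-Structured d w mono
    (reflect-Congruent d mono (Structured⇒Congruent {w = w} st)) (short (elems (1 + m) ≤-refl))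
  where
  N = 1 + m
  ring : ∀ d q → d * q + d ≡ (1 + q) * d
  ring = solve-∀
  short : ∃[ q ] (reflect a N N ≡ reflect a N 0 + d * q × q + 2 ≤ 2 + m + w) → a N + d ≤ a 0 + (1 + m + w) * d
  short (q , eq , q+2≤) = linear 6 (λ aN a₀ r x d y → r :+ a₀ :≡ aN ⇒ r :≡ x ⇒ x :+ d :≤ y ⇒
      ⊢ aN :+ d :≤ a₀ :+ y) refl
    (a N ∷ a 0 ∷ reflect a N N ∷ d * q ∷ d ∷ (1 + m + w) * d ∷ [])
    (reflect-+ mono N 0 (+-identityʳ N)) (trans eq (cong (_+ d * q) (n∸n≡0 (a N))))
    (≤-trans (≤-reflexive (ring d q)) (*-monoˡ-≤ d (ℕ.s≤s⁻¹ (subst (_≤ 2 + m + w) (+-comm q 2) q+2≤))))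

reflect-Small : ∀ {a N w} → Mono a (suc N) → Small a (suc N) w → Small (reflect a N) (suc N) w
reflect-Small mono small = cap-subset Pair⇒Sums₂ (reflect-Cap mono (cap-subset Sums₂⇒Pair small))

-- The prefix has no larger excess, so it is structured, and its last successor can be appended.
Inverse₂-suc : ∀ {k w} → 2 * w ≤ suc k → w + 2 ≤ suc k → Inverse₂ (2 + k) w → Inverse₂ (3 + k) w
Inverse₂-suc 2w≤ w+2≤ inverse mono small =
  append mono 2w≤ w+2≤ (inverse (Mono-≤ (n≤1+n _) mono) (Small-shrink mono small)) small

-- The parameter 0 would put the number of sums below the minimum, so the induction on `w` starts
-- from an absurdity.
Small₀ : ∀ {a m} → Mono a (2 + m) → ¬ Small a (2 + m) 0
Small₀ {m = m} mono small = linear 1 (λ m → 2 :* (con 2 :+ m) :+ con 4 :≤ con 3 :+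
    (2 :* (con 2 :+ m) :+ con 0) ⇒ ⊢⊥) refl
  (m ∷ []) (pair-lower m mono small)

-- An unstable deletion lowers the excess; the case `w` then handles the prefix and `append`
-- restores the deleted term.
stable-or-structured : ∀ {a m w} → Inverse₂ (2 + m) w → 2 * suc w ≤ suc m → w + 2 ≤ m → Mono a (3 + m) →
                       Small a (3 + m) (suc w) → Structured a (3 + m) (suc w) ⊎ Stable a m
stable-or-structured inverse 2w≤ w+2≤ mono small with Small-drop mono small
... | inj₁ stable = inj₂ stable
... | inj₂ small′ = inj₁ (append mono 2w≤ (s≤s w+2≤)
        (Structured-weaken (inverse (Mono-≤ (n≤1+n _) mono) small′)) small)

stable₀ : ∀ {a m} → Mono a (3 + m) → Small a (3 + m) 1 → Stable a m
stable₀ mono small with Small-drop mono small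
... | inj₁ stable = stable
... | inj₂ small′ = contradiction small′ (Small₀ (Mono-≤ (n≤1+n _) mono))

Run : (ℕ → ℕ) → ℕ → ℕ → Set
Run a t d = a (1 + t) ≡ a t + d × a (2 + t) ≡ a (1 + t) + d × a (3 + t) ≡ a (2 + t) + d ×
            a (4 + t) ≡ a (3 + t) + d

-- Two consecutive stable deletions give three linear relations among the last five terms, which
-- make their four gaps equal.
top-run : ∀ {a t} → Mono a (5 + t) → Stable a (2 + t) → Stable a (1 + t) →
          ∃[ d ] (Congruent a (5 + t) d × Run a t d)
top-run {a} {t} mono stable stable′ =
    d , Stable-Congruent mono stable (sym eq₄) (sym eq₃) , eq₁ , eq₂ , eq₃ , eq₄
  where
  first = Stable-first mono′ stable′
    where mono′ = Mono-≤ (n≤1+n _) mono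
  second = Stable-first mono stable
  third = Stable-second mono stable second first
  d = a (4 + t) ∸ a (3 + t)
  eq₄ : a (4 + t) ≡ a (3 + t) + d
  eq₄ = sym (m+[n∸m]≡n (<⇒≤ (mono (3 + t) (4 + t) ≤-refl ≤-refl)))
  vals = a t ∷ a (1 + t) ∷ a (2 + t) ∷ a (3 + t) ∷ a (4 + t) ∷ d ∷ []
  eq₁ : a (1 + t) ≡ a t + d
  eq₁ = linear 6 (λ x y z u v d → u :+ x :≡ z :+ y ⇒ v :+ y :≡ u :+ z ⇒ v :+ x :≡ u :+ y ⇒ v :≡ u :+ d ⇒
      ⊢ y :≡ x :+ d) refl
    vals first second third eq₄
  eq₂ : a (2 + t) ≡ a (1 + t) + d
  eq₂ = linear 6 (λ x y z u v d → u :+ x :≡ z :+ y ⇒ v :+ y :≡ u :+ z ⇒ v :+ x :≡ u :+ y ⇒ v :≡ u :+ d ⇒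
      ⊢ z :≡ y :+ d) refl
    vals first second third eq₄
  eq₃ : a (3 + t) ≡ a (2 + t) + d
  eq₃ = linear 6 (λ x y z u v d → u :+ x :≡ z :+ y ⇒ v :+ y :≡ u :+ z ⇒ v :+ x :≡ u :+ y ⇒ v :≡ u :+ d ⇒
      ⊢ u :≡ z :+ d) refl
    vals first second third eq₄

FlatEnds : (ℕ → ℕ) → ℕ → Set
FlatEnds a t = ∃[ d ] (Congruent a (5 + t) d × Run a t d × Run a 0 d)

-- The common differences at both ends agree, since each divides the other.
flat-ends : ∀ {a t} → Mono a (5 + t) → Stable a (2 + t) → Stable a (1 + t) →
            Stable (reflect a (4 + t)) (2 + t) → Stable (reflect a (4 + t)) (1 + t) →
            FlatEnds a t
flat-ends {a} {t} mono s₁ s₂ r₁ r₂ with top-run mono s₁ s₂ | top-run (reflect-Mono mono) r₁ r₂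
... | d , cong₁ , e₁ , e₂ , e₃ , e₄ | d′ , cong₂′ , f₁ , f₂ , f₃ , f₄ =
    d , cong₁ , (e₁ , e₂ , e₃ , e₄) ,
    subst (Run a 0) (sym d≡d′) (g₄ , g₃ , g₂ , g₁)
  where
  N = 4 + t
  c = reflect a N
  cong′ = reflect-Congruent d′ mono cong₂′
  opp : ∀ i j → i + j ≡ N → c i + a j ≡ a N
  opp = reflect-+ mono
  flip : ∀ i j → i + j ≡ N → c (suc i) ≡ c i + d′ → ∀ j′ → suc i + j′ ≡ N → a j ≡ a j′ + d′
  flip i j eq step j′ eq′ = linear 6 (λ x y u v s d → x :+ u :≡ s ⇒ y :+ v :≡ s ⇒ y :≡ x :+ d ⇒ ⊢ u :≡ v :+ d)
      refl
    (c i ∷ c (suc i) ∷ a j ∷ a j′ ∷ a N ∷ d′ ∷ []) (opp i j eq) (opp (suc i) j′ eq′) step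
  g₁ = flip t 4 (+-comm t 4) f₁ 3 (cong suc (+-comm t 3))
  g₂ = flip (1 + t) 3 (cong suc (+-comm t 3)) f₂ 2 (cong (λ v → 2 + v) (+-comm t 2))
  g₃ = flip (2 + t) 2 (cong (λ v → 2 + v) (+-comm t 2)) f₃ 1 (cong (λ v → 3 + v) (+-comm t 1))
  g₄ = flip (3 + t) 1 (cong (λ v → 3 + v) (+-comm t 1)) f₄ 0 (cong (λ v → 4 + v) (+-identityʳ t))
  d∣d′ : d ∣ d′
  d∣d′ with cong₁ 1 (s≤s (s≤s z≤n))
  ... | q , eq = divides q (trans (+-cancelˡ-≡ (a 0) d′ (d * q) (trans (sym g₄) eq)) (*-comm d q))
  d′∣d : d′ ∣ d
  d′∣d with cong′ (4 + t) ≤-refl | cong′ (3 + t) (n≤1+n _)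
  ... | x , eqx | y , eqy = ∣m+n∣m⇒∣n (subst (d′ ∣_)
    (linear 6 (λ a₀ u v p q d → v :≡ a₀ :+ p ⇒ u :≡ a₀ :+ q ⇒ v :≡ u :+ d ⇒ ⊢ p :≡ q :+ d) refl
      (a 0 ∷ a (3 + t) ∷ a (4 + t) ∷ d′ * x ∷ d′ * y ∷ d ∷ []) eqx eqy e₄) (m∣m*n x)) (m∣m*n y)
  d≡d′ : d ≡ d′
  d≡d′ = ∣-antisym d∣d′ d′∣d

stable-both : ∀ {a m N w} → (∀ {c} → Mono c (suc N) → Small c (suc N) w → Stable c m) →
              Mono a (suc N) → Small a (suc N) w → Stable a m × Stable (reflect a N) m
stable-both f mono small = f mono small , f (reflect-Mono mono) (reflect-Small mono small)

-- With no excess to lose every deletion is stable, and the run at the top already covers all four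
-- gaps.
Inverse₂-5 : Inverse₂ 5 1
Inverse₂-5 {a} mono small = conclude (flat-ends mono (proj₁ s₁) (proj₁ s₂) (proj₂ s₁) (proj₂ s₂))
  where
  s₁ : Stable a 2 × Stable (reflect a 4) 2
  s₁ = stable-both stable₀ mono small
  s₂ : Stable a 1 × Stable (reflect a 4) 1
  s₂ = stable-both (λ mono small → stable₀ (Mono-≤ (n≤1+n _) mono) (Small-shrink mono small)) mono small
  conclude : FlatEnds a 0 → Structured a 5 1
  conclude (d , cong′ , (e₁ , e₂ , e₃ , e₄) , _) = short-Structured d 1 mono cong′
    (linear 6 (λ x y z u v d → y :≡ x :+ d ⇒ z :≡ y :+ d ⇒ u :≡ z :+ d ⇒ v :≡ u :+ d ⇒
      ⊢ v :+ d :≤ x :+ 5 :* d) refl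
      (a 0 ∷ a 1 ∷ a 2 ∷ a 3 ∷ a 4 ∷ d ∷ []) e₁ e₂ e₃ e₄)

both-or : ∀ {R X Y : Set} → R ⊎ X → R ⊎ Y → R ⊎ (X × Y)
both-or (inj₁ r) _ = inj₁ r
both-or (inj₂ x) (inj₁ r) = inj₁ r
both-or (inj₂ x) (inj₂ y) = inj₂ (x , y)

or-reflected : ∀ {m w} {P : (ℕ → ℕ) → Set} →
               (∀ {c} → Mono c (2 + m) → Small c (2 + m) w → Structured c (2 + m) w ⊎ P c) →
               ∀ {a} → Mono a (2 + m) → Small a (2 + m) w →
               Structured a (2 + m) w ⊎ (P a × P (reflect a (1 + m)))
or-reflected f mono small = both-or (f mono small)
  (Sum.map₁ (reflect-Structured mono) (f (reflect-Mono mono) (reflect-Small mono small)))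

-- If the first or the second deletion from the top is unstable, the case `w` applies to what
-- remains, and the deleted terms are appended again.
two-stable : ∀ {t w} → Inverse₂ (3 + t) w → 2 * suc w ≤ 2 + t → w + 2 ≤ 1 + t → ∀ {a} → Mono a (5 + t) →
             Small a (5 + t) (suc w) → Structured a (5 + t) (suc w) ⊎ (Stable a (2 + t) × Stable a (1 + t))
two-stable {t} {w} inverse 2w≤ w+2≤ mono small = both-or
  (stable-or-structured (Inverse₂-suc (≤-trans (*-monoʳ-≤ 2 (n≤1+n w)) 2w≤) (≤-trans w+2≤ (n≤1+n _)) inverse)
    (≤-trans 2w≤ (n≤1+n _)) (≤-trans w+2≤ (n≤1+n _)) mono small)
  (Sum.map₁ (λ st → append mono (≤-trans 2w≤ (n≤1+n _)) (s≤s (≤-trans w+2≤ (n≤1+n _))) st small)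
    (stable-or-structured inverse 2w≤ w+2≤ (Mono-≤ (n≤1+n _) mono) (Small-shrink mono small)))

flat-or-structured : ∀ {t w} → Inverse₂ (3 + t) w → 2 * suc w ≤ 2 + t → w + 2 ≤ 1 + t → ∀ {a} → Mono a (5 + t) →
                     Small a (5 + t) (suc w) → Structured a (5 + t) (suc w) ⊎ FlatEnds a t
flat-or-structured inverse 2w≤ w+2≤ mono small = Sum.map₂
    (λ ((s₁ , s₂) , (r₁ , r₂)) → flat-ends mono s₁ s₂ r₁ r₂)
  (or-reflected (two-stable inverse 2w≤ w+2≤) mono small)

≤! : ∀ {m n} {m≤n : True (m ≤? n)} → m ≤ n
≤! {m≤n = m≤n} = toWitness m≤n

-- The runs at the two ends overlap, so all gaps are equal.
Inverse₂-7 : Inverse₂ 7 2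
Inverse₂-7 {a} mono small = [ id , conclude ]′ (flat-or-structured Inverse₂-5 ≤! ≤! mono small)
  where
  conclude : FlatEnds a 2 → Structured a 7 2
  conclude (d , cong′ , (e₁ , e₂ , e₃ , e₄) , (f₁ , f₂ , _ , _)) = short-Structured d 2 mono cong′
    (linear 8 (λ x₀ x₁ x₂ x₃ x₄ x₅ x₆ d → x₁ :≡ x₀ :+ d ⇒ x₂ :≡ x₁ :+ d ⇒ x₃ :≡ x₂ :+ d ⇒ x₄ :≡ x₃ :+ d ⇒
      x₅ :≡ x₄ :+ d ⇒ x₆ :≡ x₅ :+ d ⇒ ⊢ x₆ :+ d :≤ x₀ :+ 8 :* d) refl
      (a 0 ∷ a 1 ∷ a 2 ∷ a 3 ∷ a 4 ∷ a 5 ∷ a 6 ∷ d ∷ []) f₁ f₂ e₁ e₂ e₃ e₄)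

-- The two runs meet at index 4, so again no gap is left over.
Inverse₂-9 : Inverse₂ 9 3
Inverse₂-9 {a} mono small = [ id , conclude ]′ (flat-or-structured Inverse₂-7 ≤! ≤! mono small)
  where
  conclude : FlatEnds a 4 → Structured a 9 3
  conclude (d , cong′ , (e₁ , e₂ , e₃ , e₄) , (f₁ , f₂ , f₃ , f₄)) = short-Structured d 3 mono cong′
    (linear 10 (λ x₀ x₁ x₂ x₃ x₄ x₅ x₆ x₇ x₈ d → x₁ :≡ x₀ :+ d ⇒ x₂ :≡ x₁ :+ d ⇒ x₃ :≡ x₂ :+ d ⇒ x₄ :≡ x₃ :+ d ⇒
      x₅ :≡ x₄ :+ d ⇒ x₆ :≡ x₅ :+ d ⇒ x₇ :≡ x₆ :+ d ⇒ x₈ :≡ x₇ :+ d ⇒ ⊢ x₈ :+ d :≤ x₀ :+ 11 :* d) refl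
      (a 0 ∷ a 1 ∷ a 2 ∷ a 3 ∷ a 4 ∷ a 5 ∷ a 6 ∷ a 7 ∷ a 8 ∷ d ∷ []) f₁ f₂ f₃ f₄ e₁ e₂ e₃ e₄)

-- The runs leave three gaps between indices 4 and 7. A third stable deletion at each end settles
-- the outer two, and the middle gap is only bounded.
Inverse₂-12 : Inverse₂ 12 4
Inverse₂-12 {a} mono small = [ id , conclude ]′ (both-or (two mono small) (both-or
    (flat-or-structured inverse-10 ≤! ≤! mono small) (or-reflected third mono small)))
  where
  inverse-10 : Inverse₂ 10 3
  inverse-10 = Inverse₂-suc ≤! ≤! Inverse₂-9
  two : ∀ {c} → Mono c 12 → Small c 12 4 → Structured c 12 4 ⊎ Stable c 9
  two mono small = Sum.map₂ proj₁ (two-stable inverse-10 ≤! ≤! mono small)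
  third : ∀ {c} → Mono c 12 → Small c 12 4 → Structured c 12 4 ⊎ Stable c 7
  third mono small = Sum.map₁ (λ st → append mono ≤! ≤! (append mono-11 ≤! ≤! st small-11) small)
      (stable-or-structured Inverse₂-9 ≤! ≤! mono-10 (Small-shrink mono-11 small-11))
    where
    mono-11 = Mono-≤ ≤! mono
    mono-10 = Mono-≤ ≤! mono
    small-11 = Small-shrink mono small
  c = reflect a 11
  opp : ∀ i j → i + j ≡ 11 → c i + a j ≡ a 11
  opp = reflect-+ mono
  -- Stability writes `a 11 + a 5` as a sum of two terms with distinct indices between 6 and 10.
  -- Hence the gap from `a 5` to `a 6` is at most `a 11 - a 7`, that is `4 * d`.
  middle : Stable a 9 → a 6 + a 7 ≤ a 11 + a 5
  middle stable with stable 5 ≤!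
  ... | p , p<n , q , q<n , p<q , eq = ≤-trans (+-mono-≤
      (Mono-weak mono 6 p 5<p (≤-trans p<n ≤!)) (Mono-weak mono 7 q (≤-trans (s≤s 5<p) p<q) (≤-trans q<n ≤!)))
        (≤-reflexive eq)
    where
    5<p : 5 < p
    5<p = ≰⇒> λ p≤5 → linear 4 (λ x y z t → x :≤ z ⇒ y :< t ⇒ x :+ y :≡ t :+ z ⇒ ⊢⊥) refl
        (a p ∷ a q ∷ a 5 ∷ a 11 ∷ [])
      (Mono-weak mono p 5 p≤5 ≤!) (mono q 11 q<n ≤!) eq
  conclude : Stable a 9 × FlatEnds a 7 × Stable a 7 × Stable c 7 → Structured a 12 4
  conclude (stable , (d , cong′ , (e₁ , e₂ , e₃ , e₄) , (f₁ , f₂ , f₃ , f₄)) , stable₇ , stable₇′) =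
    short-Structured d 4 mono cong′
      -- Length at most (4 + 1 + 4 + 1 + 4) d = 14 d, which is exactly what `w = 4` allows for 12
      -- terms.
      (linear 7 (λ x₀ x₄ x₅ x₆ x₇ x₁₁ d → x₄ :≡ x₀ :+ 4 :* d ⇒ x₅ :≡ x₄ :+ d ⇒ x₇ :≡ x₆ :+ d ⇒
        x₁₁ :≡ x₇ :+ 4 :* d ⇒
        x₆ :+ x₇ :≤ x₁₁ :+ x₅ ⇒ ⊢ x₁₁ :+ d :≤ x₀ :+ 15 :* d) refl
        (a 0 ∷ a 4 ∷ a 5 ∷ a 6 ∷ a 7 ∷ a 11 ∷ d ∷ []) a₄ a₅ a₇ a₁₁ (middle stable))
    where
    sum-up : ∀ x y z u v → y ≡ x + d → z ≡ y + d → u ≡ z + d → v ≡ u + d → v ≡ x + 4 * d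
    sum-up x y z u v = linear 6 (λ x y z u v d → y :≡ x :+ d ⇒ z :≡ y :+ d ⇒ u :≡ z :+ d ⇒ v :≡ u :+ d ⇒
        ⊢ v :≡ x :+ 4 :* d) refl
      (x ∷ y ∷ z ∷ u ∷ v ∷ d ∷ [])
    a₄ = sum-up (a 0) (a 1) (a 2) (a 3) (a 4) f₁ f₂ f₃ f₄
    a₁₁ = sum-up (a 7) (a 8) (a 9) (a 10) (a 11) e₁ e₂ e₃ e₄
    a₇ : a 7 ≡ a 6 + d
    a₇ = linear 5 (λ x₆ x₇ x₈ x₉ d → x₉ :+ x₆ :≡ x₈ :+ x₇ ⇒ x₉ :≡ x₈ :+ d ⇒ ⊢ x₇ :≡ x₆ :+ d) refl
      (a 6 ∷ a 7 ∷ a 8 ∷ a 9 ∷ d ∷ []) (Stable-first {a} {6} (Mono-≤ ≤! mono) stable₇) e₂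
    a₅ : a 5 ≡ a 4 + d
    a₅ = linear 10 (λ x₂ x₃ x₄ x₅ y₆ y₇ y₈ y₉ s d → y₉ :+ y₆ :≡ y₈ :+ y₇ ⇒ y₆ :+ x₅ :≡ s ⇒ y₇ :+ x₄ :≡ s ⇒
        y₈ :+ x₃ :≡ s ⇒ y₉ :+ x₂ :≡ s ⇒ x₃ :≡ x₂ :+ d ⇒ ⊢ x₅ :≡ x₄ :+ d) refl
      (a 2 ∷ a 3 ∷ a 4 ∷ a 5 ∷ c 6 ∷ c 7 ∷ c 8 ∷ c 9 ∷ a 11 ∷ d ∷ [])
      (Stable-first {c} {6} (Mono-≤ ≤! (reflect-Mono mono)) stable₇′) (opp 6 5 refl) (opp 7 4 refl)
        (opp 8 3 refl) (opp 9 2 refl) f₃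

Inverse₂-upward : ∀ {k w} → 2 * w ≤ suc k → w + 2 ≤ suc k → Inverse₂ (2 + k) w → ∀ {n} → 2 + k ≤ n →
    Inverse₂ n w
Inverse₂-upward {k} 2w≤ w+2≤ inverse {n} k≤n with m≤n⇒m<n∨m≡n k≤n
... | inj₂ refl = inverse
Inverse₂-upward {k} 2w≤ w+2≤ inverse {suc (suc (suc n))} _ | inj₁ (s≤s k≤n) =
  Inverse₂-suc (≤-trans 2w≤ k≤) (≤-trans w+2≤ k≤) (Inverse₂-upward 2w≤ w+2≤ inverse k≤n)
  where
  k≤ : suc k ≤ suc n
  k≤ = ℕ.s≤s⁻¹ k≤n
Inverse₂-upward 2w≤ w+2≤ inverse {suc (suc zero)} _ | inj₁ (s≤s (s≤s ()))

-- With `n = 2 + m` the hypothesis reads `n ≥ 2 * w + 4`, which is at or above the base sizes 5, 7,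
-- 9 and 12.
inverse₂ : ∀ w m → w ≤ 4 → 2 * w + 2 ≤ m → Inverse₂ (2 + m) w
inverse₂ 0 m _ _ mono small = contradiction small (Small₀ mono)
inverse₂ 1 m _ 4≤m = Inverse₂-upward ≤! ≤! Inverse₂-5 (s≤s (s≤s (≤-trans ≤! 4≤m)))
inverse₂ 2 m _ 6≤m = Inverse₂-upward ≤! ≤! Inverse₂-7 (s≤s (s≤s (≤-trans ≤! 6≤m)))
inverse₂ 3 m _ 8≤m = Inverse₂-upward ≤! ≤! Inverse₂-9 (s≤s (s≤s (≤-trans ≤! 8≤m)))
inverse₂ 4 m _ 10≤m = Inverse₂-upward ≤! ≤! Inverse₂-12 (s≤s (s≤s 10≤m))
inverse₂ (suc (suc (suc (suc (suc _))))) m (s≤s (s≤s (s≤s (s≤s ())))) _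

-- More summands

-- For `h + m` terms the minimum is `h * m + 1`, so the excess is at most `w - 1`.
SmallSums : (ℕ → ℕ) → ℕ → ℕ → ℕ → Set
SmallSums a h m w = Cap (Sums a h (h + m)) 0 (h * m + w)

Inverse : ℕ → ℕ → ℕ → Set
Inverse h m w = ∀ {a} → Mono a (h + m) → SmallSums a h m w → Structured a (h + m) w

-- Besides a (g + m) + s for s a sum of g smaller terms, there are the sums of the g least terms and one more.
drop-max : ∀ {a g′ m w} β → let g = suc g′; l = g′ + m in Mono a (suc (g + m)) → SmallSums a (suc g) m w →
           a l + β < a (suc l) →
           (∀ i → i < β → Sums a (suc g) (suc (g + m)) (bottom a g + (a l + suc i))) →
           Cap (Sums a g (g + m)) β (g * m + w)
drop-max {a} {g′} {m} {w} β mono small gap fill = cap-weaken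
    (linear 4 (λ m β x w → ⊢ m :+ x :+ w :+ β :≤ x :+ w :+ (m :+ β :+ con 0)) refl (m ∷ β ∷ g * m ∷ w ∷ []))
    (subst (λ y → Cap (Sums a g K) (y + 0) (suc g * m + w)) size
      (cap-map {P = Topped} (λ s → a K + s) (λ s σ → s , σ , refl) (λ s t _ _ → +-cancelˡ-≡ (a K) s t)
        (cap-grow {Q = Topped} (lows ++ highs) (Unique.++⁺ (applyUpTo-unique low m low-mono)
          (applyUpTo-unique high β high-mono) disjoint)
          (All.++⁺ (applyUpTo-All low m low-sum) (applyUpTo-All high β fill))
          (All.++⁺ (applyUpTo-All low m λ i i<m → fresh (low< i i<m))
            (applyUpTo-All high β λ i i<β → fresh (high< i i<β)))
          (λ s (s′ , σ , eq) → subst (Sums a (suc g) (suc K)) (sym eq) (take σ)) small)))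
  where
  g = suc g′
  l = g′ + m
  K = g + m
  Topped : ℕ → Set
  Topped v = ∃[ s ] (Sums a g K s × v ≡ a K + s)
  low high : ℕ → ℕ
  low i = bottom a g + a (g + i)
  high i = bottom a g + (a l + suc i)
  lows = applyUpTo low m
  highs = applyUpTo high β
  size : length (lows ++ highs) ≡ m + β
  size = trans (length-++ lows {highs}) (cong₂ _+_ (length-applyUpTo low m) (length-applyUpTo high β))
  index< : ∀ {i} → i < m → g + i < suc K
  index< i<m = <-trans (+-monoʳ-< g i<m) (n<1+n K)
  low-mono : Mono low m
  low-mono i j i<j j<m = +-monoʳ-< (bottom a g) (mono (g + i) (g + j) (+-monoʳ-< g i<j) (index< j<m))
  high-mono : Mono high β
  high-mono i j i<j _ = +-monoʳ-< (bottom a g) (+-monoʳ-< (a l) (s≤s i<j))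
  low≤ : ∀ i → i < m → low i ≤ bottom a g + a l
  low≤ i i<m = +-monoʳ-≤ (bottom a g) (Mono-weak mono (g + i) l (ℕ.s≤s⁻¹ (+-monoʳ-< g i<m)) (n≤1+n (suc l)))
  disjoint : ∀ {v} → ¬ (v ∈ lows × v ∈ highs)
  disjoint (v∈lows , v∈highs) with ∈-applyUpTo⁻ low v∈lows | ∈-applyUpTo⁻ high v∈highs
  ... | i , i<m , refl | j , j<β , eq = linear 4 (λ v b x j → v :≤ b :+ x ⇒ v :≡ b :+ (x :+ (con 1 :+ j)) ⇒
      ⊢⊥) refl
    (low i ∷ bottom a g ∷ a l ∷ j ∷ []) (low≤ i i<m) eq
  low-sum : ∀ i → i < m → Sums a (suc g) (suc K) (low i)
  low-sum i i<m = subst (Sums a (suc g) (suc K)) (+-comm (a (g + i)) (bottom a g))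
    (Sums-extend (index< i<m) (Sums-take (g + i) (m≤m+n g i) (bottom-Sums a g)))
  low< : ∀ i → i < m → low i < bottom a g + a K
  low< i i<m = +-monoʳ-< (bottom a g) (mono (g + i) K (+-monoʳ-< g i<m) (n<1+n K))
  high< : ∀ i → i < β → high i < bottom a g + a K
  high< i i<β = +-monoʳ-< (bottom a g) (≤-trans (s≤s (+-monoʳ-≤ (a l) i<β)) gap)
  -- A sum using the last term is at least that term plus the `g` least ones.
  fresh : ∀ {v} → v < bottom a g + a K → ¬ Topped v
  fresh v< (s , σ , refl) = linear 3 (λ b x s → x :+ s :< b :+ x ⇒ b :≤ s ⇒ ⊢⊥) refl (bottom a g ∷ a K ∷ s ∷ [])
    v< (bottom-least (Mono-≤ (n≤1+n K) mono) σ)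

-- Take the `g` least terms without `b g′` and let two larger ones replace `b g′` and `suc y`:
-- `two-sum` on `[b g′ + 1, y]` supplies them, since their total is the sum of those ends.
gap-filled : ∀ {b g′ m} y → let g = suc g′; l = g′ + m in Mono b (suc (g + m)) → b l ≤ y → g ≤ l →
             y + 2 * g < suc (b g′) + 2 * l → Sums b (suc g) (suc (g + m)) (bottom b g + suc y)
gap-filled {b} {g′} {m} y mono bl≤y g≤l size =
  build (two-sum b (suc K) mono (suc (b g′)) y g l g≤l (n≤1+n K)
      (mono g′ g (n<1+n g′) (s≤s (s≤s (m≤m+n g′ m)))) bl≤y size)
  where
  g = suc g′
  l = g′ + m
  K = g + m
  build : ∃[ p ] ∃[ q ] (g ≤ p × p < q × q ≤ l × b p + b q ≡ suc (b g′) + y) →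
          Sums b (suc g) (suc K) (bottom b g + suc y)
  build (p , q , g≤p , p<q , q≤l , eq) = subst (Sums b (suc g) (suc K))
    (linear 5 (λ p q x s y → p :+ q :≡ con 1 :+ x :+ y ⇒ ⊢ q :+ (p :+ s) :≡ x :+ s :+ (con 1 :+ y)) refl
      (b p ∷ b q ∷ b g′ ∷ bottom b g′ ∷ y ∷ []) eq)
    (Sums-extend (s≤s (≤-trans q≤l (n≤1+n l))) (Sums-take q p<q
      (Sums-take p (≤-trans (n≤1+n g′) g≤p) (bottom-Sums b g′))))

-- If all gaps after the first were at least `2 * d`, the progression would be too long. The first
-- gap is avoided so that the one found also survives deleting the least term.
unit-gap : ∀ {a r w} → Mono a (2 + r) → ((d , _) : Structured a (2 + r) w) → w ≤ r →
           ∃[ i ] (1 ≤ i × suc i < 2 + r × a (suc i) ≡ a i + d)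
unit-gap {a} {r} {w} mono st@(d , elems) w≤r
  with anyUpTo? (λ i → a (2 + i) ≟ a (1 + i) + d) r
... | yes (i , i<r , eq) = suc i , s≤s z≤n , s≤s (s≤s i<r) , eq
... | no none-unit = ⊥-elim (contra (elems (1 + r) ≤-refl))
  where
  cong′ = Structured⇒Congruent {w = w} st
  0<d = 0<scale d mono cong′
  normal = normalise d mono cong′
  b = proj₁ normal
  aff = proj₁ (proj₂ normal)
  b-mono = proj₁ (proj₂ (proj₂ normal))
  b₀≡0 = proj₂ (proj₂ (proj₂ normal))
  add-unit : ∀ x y → x + d * y + d ≡ x + d * suc y
  add-unit x y = trans (+-assoc x (d * y) d) (cong (λ v → x + v) (trans (+-comm (d * y) d) (sym (*-suc d y))))
  double : ∀ j → j ≤ r → suc (2 * j) ≤ b (suc j)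
  double zero _ = ≤-trans (≤-reflexive (cong suc (sym b₀≡0))) (b-mono 0 1 (s≤s z≤n) (s≤s (s≤s z≤n)))
  double (suc j) j<r with m≤n⇒m<n∨m≡n (b-mono (1 + j) (2 + j) (n<1+n _) (s≤s (s≤s j<r)))
  ... | inj₁ 2≤ = linear 3 (λ j x y → con 1 :+ 2 :* j :≤ x ⇒ con 1 :+ x :< y ⇒
      ⊢ con 1 :+ 2 :* (con 1 :+ j) :≤ y) refl
          (j ∷ b (suc j) ∷ b (2 + j) ∷ []) (double j (<⇒≤ j<r)) 2≤
  ... | inj₂ unit = contradiction (j , j<r , trans (aff (2 + j) (s≤s (s≤s j<r)))
          (trans (cong (λ v → a 0 + d * v) (sym unit)) (trans (sym (add-unit (a 0) (b (suc j))))
            (cong (_+ d) (sym (aff (1 + j) (s≤s (s≤s (<⇒≤ j<r))))))))) none-unit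
  contra : ∃[ q ] (a (1 + r) ≡ a 0 + d * q × q + 2 ≤ 2 + r + w) → ⊥
  contra (q , eq , q+2≤) = linear 4 (λ r w x q → con 1 :+ 2 :* r :≤ x ⇒ x :≡ q ⇒
      q :+ con 2 :≤ con 2 :+ r :+ w ⇒ w :≤ r ⇒ ⊢⊥) refl
    (r ∷ w ∷ b (suc r) ∷ q ∷ []) (double r ≤-refl) (scale-cancel (a 0) d 0<d _ q
      (trans (sym (aff (1 + r) ≤-refl)) eq)) q+2≤ w≤r

∣-difference : ∀ {d e x y u v c} → u ≡ c + d * x → v ≡ c + d * y → u ≡ v + e → d ∣ e
∣-difference {d} {e} {x} {y} {u} {v} {c} eu ev eq = ∣m+n∣m⇒∣n (subst (d ∣_)
  (linear 6 (λ u v c p q e → u :≡ c :+ p ⇒ v :≡ c :+ q ⇒ u :≡ v :+ e ⇒ ⊢ p :≡ q :+ e) refl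
    (u ∷ v ∷ c ∷ d * x ∷ d * y ∷ e ∷ []) eu ev eq) (m∣m*n x)) (m∣m*n y)

-- The gap avoids the first step of `y`, so its mirror image lies among the terms of `x` known to be
-- congruent modulo `d`.
opposite-gap : ∀ {x y : ℕ → ℕ} {K M d e} → (∀ i j → i + j ≡ K → x i + y j ≡ M) → Congruent x K d →
               ∃[ i ] (1 ≤ i × suc i < K × y (suc i) ≡ y i + e) → d ∣ e
opposite-gap {x} {y} {K} {M} {d} {e} opp cong′ (i@(suc i′) , _ , i+1<K , step) =
  divide (cong′ (suc k) (subst (suc (suc k) ≤_) eqK (s≤s (s≤s (m≤n+m k i′)))))
      (cong′ k (subst (suc k ≤_) eqK (s≤s (m≤n+m k (suc i′)))))
  where
  k = K ∸ suc i
  eqK : suc (suc (i′ + k)) ≡ K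
  eqK = m+[n∸m]≡n (<⇒≤ i+1<K)
  divide : ∃[ p ] x (suc k) ≡ x 0 + d * p → ∃[ q ] x k ≡ x 0 + d * q → d ∣ e
  divide (p , eqp) (q , eqq) = ∣-difference {x = p} {q} {c = x 0} eqp eqq
    (linear 6 (λ x₁ x₀ y₁ y₀ M e → x₁ :+ y₀ :≡ M ⇒ x₀ :+ y₁ :≡ M ⇒ y₁ :≡ y₀ :+ e ⇒ ⊢ x₁ :≡ x₀ :+ e) refl
      (x (suc k) ∷ x k ∷ y (suc i) ∷ y i ∷ M ∷ e ∷ [])
      (opp (suc k) i (trans (cong suc (+-comm k (suc i′))) eqK))
      (opp k (suc i) (trans (+-comm k (suc i)) eqK)) step)

module _ {f m w : ℕ} (w≤4 : w ≤ 4) (large : 2 * w + 2 ≤ m)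
         (inverse : ∀ v → v ≤ 4 → 2 * v + 2 ≤ m → Inverse (2 + f) m v) where

  private
    g r K : ℕ
    g = 2 + f
    r = f + m
    K = 2 + r

    w≤m : w ≤ m
    w≤m = linear 2 (λ w m → 2 :* w :+ con 2 :≤ m ⇒ ⊢ w :≤ m) refl (w ∷ m ∷ []) large

    w≤r : w ≤ r
    w≤r = ≤-trans w≤m (m≤n+m m f)

  -- `drop-max` without gap sums: the excess of the prefix is at most that of the whole.
  prefix-structured : ∀ {a} → Mono a (suc K) → SmallSums a (suc g) m w → Structured a K w
  prefix-structured {a} mono small = inverse w w≤4 large (Mono-≤ (n≤1+n K) mono)
    (drop-max 0 mono small (subst (_< a K) (sym (+-identityʳ (a (1 + r))))
      (mono (1 + r) K (n<1+n _) (n<1+n K))) λ _ ())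

  -- Each of the β integers inside the last gap yields a sum below all those using the last term, and so
  -- costs the remaining terms one unit of slack.
  last-bound : ∀ {b β} → Mono b (suc K) → b 0 ≡ 0 → SmallSums b (suc g) m w → b K ≡ suc (b (1 + r) + β) →
      β + 1 ≤ w →
               b (1 + r) + 2 ≤ K + w → ∃[ i ] (1 ≤ i × suc i < K × b (suc i) ≡ b i + 1) → b K + 2 ≤ suc K + w
  last-bound {b} {β} mono b₀≡0 small eqK β<w bl≤ (i , _ , i+1<K , unit) = conclude
      (inverse v v≤4 v-large (Mono-≤ (n≤1+n K) mono) small′)
    where
    l = 1 + r
    v = w ∸ β
    β+v : β + v ≡ w
    β+v = m+[n∸m]≡n (≤-trans (m≤m+n β 1) β<w)
    v≤w : v ≤ w
    v≤w = m∸n≤m w β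
    v≤4 = ≤-trans v≤w w≤4
    v-large : 2 * v + 2 ≤ m
    v-large = linear 3 (λ v w m → v :≤ w ⇒ 2 :* w :+ con 2 :≤ m ⇒ ⊢ 2 :* v :+ con 2 :≤ m) refl
        (v ∷ w ∷ m ∷ []) v≤w large
    g≤l : g ≤ l
    g≤l = s≤s (linear 3 (λ f w m → 2 :* w :+ con 2 :≤ m ⇒ ⊢ con 1 :+ f :≤ f :+ m) refl (f ∷ w ∷ m ∷ []) large)
    index≤ : 1 + f ≤ b (1 + f)
    index≤ = subst (λ y → y + (1 + f) ≤ b (1 + f)) b₀≡0
        (Mono-gap mono 0 (1 + f) (s≤s (s≤s (≤-trans (m≤m+n f m) (n≤1+n r)))))
    fill : ∀ j → j < β → Sums b (suc g) (suc K) (bottom b g + (b l + suc j))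
    fill j j<β = subst (λ y → Sums b (suc g) (suc K) (bottom b g + y)) (sym (+-suc (b l) j))
      (gap-filled (b l + j) mono (m≤m+n (b l) j) g≤l
        -- The prefix ends at most at `K + w - 2` and `j` is at most `w - 2`, so `2 * w + 2 ≤ m`
        -- keeps the interval more than half full.
        (linear 7 (λ x y j β f m w → j :< β ⇒ β :+ con 1 :≤ w ⇒ x :+ con 2 :≤ con 2 :+ (f :+ m) :+ w ⇒
          con 1 :+ f :≤ y ⇒ 2 :* w :+ con 2 :≤ m ⇒
          ⊢ x :+ j :+ 2 :* (con 2 :+ f) :< con 1 :+ y :+ 2 :* (con 1 :+ (f :+ m))) refl
          (b l ∷ b (1 + f) ∷ j ∷ β ∷ f ∷ m ∷ w ∷ []) j<β β<w bl≤ index≤ large))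
    small′ : SmallSums b g m v
    small′ = cap-weaken (linear 4 (λ x w β v → β :+ v :≡ w ⇒ ⊢ x :+ w :+ con 0 :≤ x :+ v :+ β) refl
        (g * m ∷ w ∷ β ∷ v ∷ []) β+v)
      (drop-max β mono small (≤-reflexive (sym eqK)) fill)
    conclude : Structured b K v → b K + 2 ≤ suc K + w
    conclude st@(d , elems) = bound (elems l (n<1+n _))
      where
      cong′ = Structured⇒Congruent {w = v} st
      -- The prefix contains two terms at distance 1, so its difference divides 1.
      d≡1 : d ≡ 1
      d≡1 with cong′ (suc i) i+1<K | cong′ i (<-trans (n<1+n i) i+1<K)
      ... | x , ex | y , ey = ∣1⇒≡1 (∣-difference {x = x} {y} {c = b 0} ex ey unit)
      bound : ∃[ q ] (b l ≡ b 0 + d * q × q + 2 ≤ K + v) → b K + 2 ≤ suc K + w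
      bound (q , eq , q+2≤) = linear 7 (λ xK xl β q k v w → xK :≡ con 1 :+ (xl :+ β) ⇒ xl :≡ q ⇒
          q :+ con 2 :≤ k :+ v ⇒ β :+ v :≡ w ⇒
          ⊢ xK :+ con 2 :≤ con 1 :+ k :+ w) refl (b K ∷ b l ∷ β ∷ q ∷ K ∷ v ∷ w ∷ [])
        eqK (trans eq (trans (cong₂ _+_ b₀≡0 (cong (_* q) d≡1)) (+-identityʳ q))) q+2≤ β+v

  -- The set without its greatest element and the set without its least one are both structured. A
  -- unit gap of each lies in the other, so the differences agree; after dividing by `d`, only the
  -- last gap remains, which `last-bound` treats.
  Inverse-suc : Inverse (suc g) m w
  Inverse-suc {a} mono small = d , λ i i<n → b i , aff i i<n , ≤-trans
      (+-monoˡ-≤ 2 (Mono-weak b-mono i K (ℕ.s≤s⁻¹ i<n) ≤-refl)) bound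
    where
    l = 1 + r
    c = reflect a K
    c-mono : Mono c (suc K)
    c-mono = reflect-Mono mono
    opp : ∀ i j → i + j ≡ K → c i + a j ≡ a K
    opp = reflect-+ mono
    stA : Structured a K w
    stA = prefix-structured mono small
    stC : Structured c K w
    stC = prefix-structured c-mono (reflect-Cap mono small)
    d = proj₁ stA
    d′ = proj₁ stC
    congA = Structured⇒Congruent {w = w} stA
    congC = Structured⇒Congruent {w = w} stC
    gapA = unit-gap (Mono-≤ (n≤1+n K) mono) stA w≤r
    gapC = unit-gap (Mono-≤ (n≤1+n K) c-mono) stC w≤r
    d′≡d : d′ ≡ d
    d′≡d = ∣-antisym (opposite-gap {x = c} {a} opp congC gapA)
      (opposite-gap {x = a} {c} (λ i j eq → trans (+-comm (a i) (c j))
        (opp j i (trans (+-comm j i) eq))) congA gapC)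
    c-last = proj₂ stC l (n<1+n _)
    q = proj₁ c-last
    -- The last quotient of the reflected prefix measures the distance from `a 1` to `a K`.
    aK : a K ≡ a 1 + d * q
    aK = trans (sym (opp l 1 (+-comm l 1))) (trans (+-comm (c l) (a 1)) (cong (λ v → a 1 + v)
      (trans (proj₁ (proj₂ c-last)) (trans (cong (_+ d′ * q) (n∸n≡0 (a K))) (cong (_* q) d′≡d)))))
    add-scaled : ∀ x y z → x + d * y + d * z ≡ x + d * (y + z)
    add-scaled x y z = trans (+-assoc x (d * y) (d * z)) (cong (λ v → x + v) (sym (*-distribˡ-+ d y z)))
    cong′ : Congruent a (suc K) d
    cong′ i (s≤s i≤K) with m≤n⇒m<n∨m≡n i≤K
    ... | inj₁ i<K = congA i i<K
    ... | inj₂ refl with congA 1 (s≤s (s≤s z≤n))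
    ...   | q₁ , eq₁ = q₁ + q , trans aK (trans (cong (_+ d * q) eq₁) (add-scaled (a 0) q₁ q))
    0<d = 0<scale d mono cong′
    normal = normalise d mono cong′
    b = proj₁ normal
    aff : Affine a (suc K) (a 0) d b
    aff = proj₁ (proj₂ normal)
    b-mono = proj₁ (proj₂ (proj₂ normal))
    b₀≡0 = proj₂ (proj₂ (proj₂ normal))
    bK : b K ≡ b 1 + q
    bK = scale-cancel (a 0) d 0<d (b K) (b 1 + q) (trans (sym (aff K ≤-refl))
      (trans aK (trans (cong (_+ d * q) (aff 1 (s≤s (s≤s z≤n)))) (add-scaled (a 0) (b 1) q))))
    bl≤ : b l + 2 ≤ K + w
    bl≤ with proj₂ stA l (n<1+n _)
    ... | x , eq , x+2≤ = subst (λ y → y + 2 ≤ K + w)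
      (sym (scale-cancel (a 0) d 0<d (b l) x (trans (sym (aff l (n≤1+n _))) eq))) x+2≤
    β = b K ∸ suc (b l)
    eqK : b K ≡ suc (b l + β)
    eqK = sym (m+[n∸m]≡n (b-mono l K (n<1+n _) (n<1+n K)))
    spread : b 1 + r ≤ b l
    spread = Mono-gap b-mono 1 r (n≤1+n _)
    -- From `b 1` to `b K` there are at most `r + w` units, of which at least `r` lie below `b l`.
    β<w : β + 1 ≤ w
    β<w = linear 7 (λ xK xl x₁ β q r w → xK :≡ con 1 :+ (xl :+ β) ⇒ xK :≡ x₁ :+ q ⇒
        q :+ con 2 :≤ con 2 :+ r :+ w ⇒ x₁ :+ r :≤ xl ⇒
        ⊢ β :+ con 1 :≤ w) refl (b K ∷ b l ∷ b 1 ∷ β ∷ q ∷ r ∷ w ∷ []) eqK bK (proj₂ (proj₂ c-last)) spread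
    gapB : ∃[ i ] (1 ≤ i × suc i < K × b (suc i) ≡ b i + 1)
    gapB with gapA
    ... | i , 1≤i , i+1<K , eq = i , 1≤i , i+1<K , scale-cancel (a 0) d 0<d (b (suc i)) (b i + 1)
      (trans (sym (aff (suc i) (<-trans i+1<K (n<1+n K))))
        (trans eq (trans (cong (_+ d) (aff i (<-trans (n<1+n i) (<-trans i+1<K (n<1+n K)))))
        (trans (cong (λ v → a 0 + d * b i + v) (sym (*-identityʳ d))) (add-scaled (a 0) (b i) 1)))))
    bound : b K + 2 ≤ suc K + w
    bound = last-bound b-mono b₀≡0 (Affine-Cap {c = a 0} 0<d aff small) eqK β<w bl≤ gapB

-- A deletion lowers the numbers of summands and of terms together, so `m` and its threshold stay
-- fixed throughout the induction.
inverse : ∀ f m w → w ≤ 4 → 2 * w + 2 ≤ m → Inverse (2 + f) m w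
inverse zero m w w≤4 large mono small = inverse₂ w m w≤4 large mono (cap-weaken
  (linear 2 (λ m w → ⊢ 2 :* m :+ w :+ con 4 :≤ 2 :* (con 2 :+ m) :+ w :+ con 0) refl (m ∷ w ∷ []))
  (cap-subset Pair⇒Sums₂ small))
inverse (suc f) m w w≤4 large = Inverse-suc w≤4 large (inverse f m)

-- From lists to sequences

-- Entries of a descending list, counted from its end.
entry : List ℕ → ℕ → ℕ
entry [] i = 0
entry (x ∷ xs) i with i ≟ length xs
... | yes _ = x
... | no _ = entry xs i

entry-top : ∀ x xs → entry (x ∷ xs) (length xs) ≡ x
entry-top x xs with length xs ≟ length xs
... | yes _ = refl
... | no ≢ = contradiction refl ≢

entry-below : ∀ x xs i → i < length xs → entry (x ∷ xs) i ≡ entry xs i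
entry-below x xs i i<n with i ≟ length xs
... | yes i≡n = contradiction i<n (<-irrefl i≡n)
... | no _ = refl

entry-All : ∀ {P : ℕ → Set} {xs} → All P xs → ∀ i → i < length xs → P (entry xs i)
entry-All {xs = x ∷ xs} (px ∷ pxs) i i<n with i ≟ length xs
... | yes _ = px
... | no i≢n with m≤n⇒m<n∨m≡n (ℕ.s≤s⁻¹ i<n)
...   | inj₁ i<n′ = entry-All pxs i i<n′
...   | inj₂ i≡n = contradiction i≡n i≢n

entry-Mono : ∀ {xs} → AllPairs _>_ xs → Mono (entry xs) (length xs)
entry-Mono {x ∷ xs} (>xs ∷ dec) i j i<j j<n with m≤n⇒m<n∨m≡n (ℕ.s≤s⁻¹ j<n)
... | inj₁ j<n′ = subst₂ _<_ (sym (entry-below x xs i (<-trans i<j j<n′))) (sym (entry-below x xs j j<n′))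
    (entry-Mono dec i j i<j j<n′)
... | inj₂ refl = subst₂ _<_ (sym (entry-below x xs i i<j)) (sym (entry-top x xs)) (entry-All >xs i i<j)

∈-entry : ∀ {v xs} → v ∈ xs → ∃[ i ] (i < length xs × entry xs i ≡ v)
∈-entry {xs = x ∷ xs} (here refl) = length xs , n<1+n _ , entry-top x xs
∈-entry {xs = x ∷ xs} (there v∈xs) with ∈-entry v∈xs
... | i , i<n , eq = i , <-trans i<n (n<1+n _) , trans (entry-below x xs i i<n) eq

Sums-cong : ∀ {a b h n s} → (∀ i → i < n → a i ≡ b i) → Sums a h n s → Sums b h n s
Sums-cong eq none = none
Sums-cong eq (skip σ) = skip (Sums-cong (λ i i<n → eq i (<-trans i<n (n<1+n _))) σ)
Sums-cong {b = b} eq (take {h} {n} {s} σ) rewrite eq n (n<1+n n) =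
  take (Sums-cong (λ i i<n → eq i (<-trans i<n (n<1+n _))) σ)

Sums-sublist : ∀ xs {h n s} → n ≡ length xs → Sums (entry xs) h n s → ∃[ B ] (B ⊆ xs × length B ≡ h × sum B ≡ s)
Sums-sublist xs _ none = [] , minimum xs , refl , refl
Sums-sublist (x ∷ xs) refl (skip σ) with Sums-sublist xs refl (Sums-cong (entry-below x xs) σ)
... | B , B⊆xs , len , eq = B , x ∷ʳ B⊆xs , len , eq
Sums-sublist (x ∷ xs) refl (take σ) with Sums-sublist xs refl (Sums-cong (entry-below x xs) σ)
... | B , B⊆xs , len , eq = x ∷ B , refl ∷ B⊆xs , cong suc len , cong₂ _+_ (sym (entry-top x xs)) eq

-- Carries a choice of terms from the sorted list back to the given one; the order inside the choice
-- may change, but not its sum.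
⊆-↭ : ∀ {B xs ys : List ℕ} → xs ↭ ys → B ⊆ xs → ∃[ C ] (C ⊆ ys × B ↭ C)
⊆-↭ {B} ↭-refl B⊆ = B , B⊆ , ↭-refl
⊆-↭ (prep x p) (.x ∷ʳ B⊆) with ⊆-↭ p B⊆
... | C , C⊆ , q = C , x ∷ʳ C⊆ , q
⊆-↭ (prep x p) (refl ∷ B⊆) with ⊆-↭ p B⊆
... | C , C⊆ , q = x ∷ C , refl ∷ C⊆ , prep x q
⊆-↭ (swap x y p) (.x ∷ʳ .y ∷ʳ B⊆) with ⊆-↭ p B⊆
... | C , C⊆ , q = C , y ∷ʳ x ∷ʳ C⊆ , q
⊆-↭ (swap x y p) (.x ∷ʳ (refl ∷ B⊆)) with ⊆-↭ p B⊆
... | C , C⊆ , q = y ∷ C , refl ∷ (x ∷ʳ C⊆) , prep y q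
⊆-↭ (swap x y p) (refl ∷ (.y ∷ʳ B⊆)) with ⊆-↭ p B⊆
... | C , C⊆ , q = x ∷ C , y ∷ʳ (refl ∷ C⊆) , prep x q
⊆-↭ (swap x y p) (refl ∷ (refl ∷ B⊆)) with ⊆-↭ p B⊆
... | C , C⊆ , q = y ∷ x ∷ C , refl ∷ (refl ∷ C⊆) , swap x y q
⊆-↭ (↭-trans p p′) B⊆ with ⊆-↭ p B⊆
... | C , C⊆ , q with ⊆-↭ p′ C⊆
...   | D , D⊆ , q′ = D , D⊆ , ↭-trans q q′

sumℤ-map : ∀ xs → sumℤ (map +_ xs) ≡ + sum xs
sumℤ-map [] = refl
sumℤ-map (x ∷ xs) = cong (λ v → + x ℤ.+ v) (sumℤ-map xs)

map-∣∣ : ∀ {A} → (∀ a → a ∈ A → + 0 ℤ.≤ a) → map +_ (map ℤ.∣_∣ A) ≡ A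
map-∣∣ {[]} nonneg = refl
map-∣∣ {a ∷ A} nonneg = cong₂ _∷_ (ℤ.0≤i⇒+∣i∣≡i (nonneg a (here refl))) (map-∣∣ λ b b∈A → nonneg b (there b∈A))

Unique-length : ∀ {A : Set} {xs ys : List A} → Unique xs → (∀ {x} → x ∈ xs → x ∈ ys) → length xs ≤ length ys
Unique-length [] _ = z≤n
Unique-length {xs = x ∷ xs} (x∉xs ∷ u) sub with ∈-∃++ (sub (here refl))
... | as , bs , refl = subst (suc (length xs) ≤_) (trans (cong suc (length-++ as))
    (sym (trans (length-++ as) (+-suc (length as) (length bs)))))
  (s≤s (Unique-length u λ {y} y∈xs → [ ∈-++⁺ˡ , other y∈xs ]′ (∈-++⁻ as (sub (there y∈xs)))))
  where
  other : ∀ {y} → y ∈ xs → y ∈ x ∷ bs → y ∈ as ++ bs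
  other y∈xs (here refl) = contradiction refl (All.lookup x∉xs y∈xs)
  other y∈xs (there y∈bs) = ∈-++⁺ʳ as y∈bs

-- Deduction of the theorem

module Descending = Data.List.Sort (Flip.decTotalOrder ≤-decTotalOrder)

descending : ∀ {xs} → Unique xs → AllPairs _>_ (Descending.sort xs)
descending {xs} u = AllPairs.zipWith (λ (x≥y , x≢y) → ≤∧≢⇒< x≥y (x≢y ∘ sym))
  ( Linked⇒AllPairs (λ x≥y y≥z → ≤-trans y≥z x≥y) (Descending.sort-↗ xs)
  , Unique-resp-↭ (setoid ℕ) (↭⇒↭ₛ (↭-sym (Descending.sort-↭ xs))) u)

gcdList-greatest : ∀ {d} A → (∀ a → a ∈ A → d ∣ ℤ.∣ a ∣) → d ∣ gcdList A
gcdList-greatest [] h = _ ∣0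
gcdList-greatest (a ∷ A) h = gcd-greatest (h a (here refl)) (gcdList-greatest A λ b b∈A → h b (there b∈A))

-- Since the minimum is 0, taking absolute values loses nothing and the sorted sequence starts at 0.
-- The difference of its progression then divides every element, hence the gcd, and so is 1.
restricted-inverse : ∀ h m w n A → 2 ≤ h → w ≤ 4 → 2 * w + 2 ≤ m → Unique A → length A ≡ h + m → MinIsZero A →
    gcdList A ≡ 1 →
                     HasCard (InRestrictedSumset h A) n → n ≡ h * m + w → ∀ a → a ∈ A → ℤ.∣ a ∣ + 2 ≤ h + m + w
restricted-inverse h@(suc (suc f)) m w n A _ w≤4 large uA lenA (0∈A , nonneg) gcd≡1 (L , uL , L⇔ , lenL) n≡ =
  bounds (inverse f m w w≤4 large mono small)
  where
  N = map ℤ.∣_∣ A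
  xs = Descending.sort N
  xs↭N : xs ↭ N
  xs↭N = Descending.sort-↭ N
  A≡ : map +_ N ≡ A
  A≡ = map-∣∣ nonneg
  uN : Unique N
  uN = Unique.map⁻ (subst Unique (sym A≡) uA)
  len : length xs ≡ h + m
  len = trans (↭-length xs↭N) (trans (length-map ℤ.∣_∣ A) lenA)
  x : ℕ → ℕ
  x = entry xs
  mono : Mono x (h + m)
  mono = subst (Mono x) len (entry-Mono (descending uN))
  restricted : ∀ s → Sums x h (h + m) s → InRestrictedSumset h A (+ s)
  restricted s σ with Sums-sublist xs (sym len) σ
  ... | B , B⊆xs , lenB , sumB with ⊆-↭ xs↭N B⊆xs
  ...   | C , C⊆N , B↭C = map +_ C , subst (map +_ C ⊆_) A≡ (Sublist.map⁺ +_ C⊆N) ,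
          trans (length-map +_ C) (trans (sym (↭-length B↭C)) lenB) ,
          trans (sumℤ-map C) (cong +_ (trans (sym (sum-↭ B↭C)) sumB))
  small : SmallSums x h m w
  -- The members of `M` become distinct entries of the list `L` of all restricted sums, so there are
  -- at most `n` of them.
  small M uM M⊂ = subst₂ _≤_ (trans (length-map +_ M) (sym (+-identityʳ (length M)))) (trans lenL n≡)
    (Unique-length (Unique.map⁺ ℤ.+-injective uM) λ {v} v∈ → Equivalence.from (L⇔ v) (member v∈))
    where
    member : ∀ {v} → v ∈ map +_ M → InRestrictedSumset h A v
    member v∈ with ∈-map⁻ +_ v∈
    ... | s , s∈M , refl = restricted s (All.lookup M⊂ s∈M)
  index : ∀ a → a ∈ A → ∃[ i ] (i < h + m × x i ≡ ℤ.∣ a ∣)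
  index a a∈A with ∈-entry (∈-resp-↭ (↭-sym xs↭N) (∈-map⁺ ℤ.∣_∣ a∈A))
  ... | i , i<n , eq = i , subst (i <_) len i<n , eq
  x₀≡0 : x 0 ≡ 0
  x₀≡0 with index (+ 0) 0∈A
  ... | i , i<n , eq = n≤0⇒n≡0 (subst (x 0 ≤_) eq (Mono-weak mono 0 i z≤n i<n))
  bounds : Structured x (h + m) w → ∀ a → a ∈ A → ℤ.∣ a ∣ + 2 ≤ h + m + w
  bounds (d , elems) a a∈A = bound (index a a∈A)
    where
    multiple : ∀ b → b ∈ A → d ∣ ℤ.∣ b ∣
    multiple b b∈A with index b b∈A
    ... | i , i<n , eq with elems i i<n
    ...   | q , eq′ , _ = divides q (trans (sym eq) (trans eq′ (trans (cong (_+ d * q) x₀≡0) (*-comm d q))))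
    d≡1 : d ≡ 1
    d≡1 = ∣1⇒≡1 (subst (d ∣_) gcd≡1 (gcdList-greatest A multiple))
    bound : ∃[ i ] (i < h + m × x i ≡ ℤ.∣ a ∣) → ℤ.∣ a ∣ + 2 ≤ h + m + w
    bound (i , i<n , eq) with elems i i<n
    ... | q , eq′ , q+2≤ = subst (λ v → v + 2 ≤ h + m + w)
      (trans (sym (trans eq′ (trans (cong₂ (λ v e → v + e * q) x₀≡0 d≡1) (+-identityʳ q)))) eq) q+2≤
restricted-inverse (suc zero) m w n A (s≤s ())

-- With `k = h + m` the expression `h k - h²` is `h m`, which removes the integer subtraction.
cancel-square : ∀ h m c n → + n ≡ (+ (h * (h + m)) ℤ.- + (h * h)) ℤ.+ + c → n ≡ h * m + c
cancel-square h m c n eq = ℤ.+-injective (trans eq (cong (λ v → v ℤ.+ + c)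
  (trans (cong (λ v → v ℤ.- + (h * h)) (trans (cong +_ (*-distribˡ-+ h h m)) (ℤ.pos-+ (h * h) (h * m))))
    (ring (+ (h * h)) (+ (h * m))))))
  where
  ring : ∀ x y → (x ℤ.+ y) ℤ.- x ≡ y
  ring = ℤ-Solver.solve-∀

interval : ∀ h k w n A t → h ≥ 3 → w ≤ 4 → h + (2 * w + 2) ≤ k → Unique A → length A ≡ k → MinIsZero A →
    gcdList A ≡ 1 →
           HasCard (InRestrictedSumset h A) n → + n ≡ (+ (h * k) ℤ.- + (h * h)) ℤ.+ + w → k + w ≡ t + 2 →
           SubsetInterval A (+ 0) (+ t)
interval h k w n A t h≥3 w≤4 k≥ uA lenA min gcd≡1 card n≡ t≡ a a∈A =
  nonneg , subst (ℤ._≤ + t) (ℤ.0≤i⇒+∣i∣≡i nonneg) (ℤ.+≤+ (+-cancelʳ-≤ 2 _ t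
    (subst (ℤ.∣ a ∣ + 2 ≤_) (trans (cong (_+ w) h+m≡k) t≡)
      (restricted-inverse h m w n A (≤-trans ≤! h≥3) w≤4 large uA (trans lenA (sym h+m≡k)) min gcd≡1 card
        (cancel-square h m w n (subst (λ v → + n ≡ (+ (h * v) ℤ.- + (h * h)) ℤ.+ + w) (sym h+m≡k) n≡)) a a∈A))))
  where
  nonneg = proj₂ min a a∈A
  m = k ∸ h
  h+m≡k : h + m ≡ k
  h+m≡k = m+[n∸m]≡n (≤-trans (m≤m+n h _) k≥)
  large : 2 * w + 2 ≤ m
  large = +-cancelˡ-≤ h _ _ (≤-trans k≥ (≤-reflexive (sym h+m≡k)))

theorem1p9 : (h k : ℕ) → h ≥ 3 → k ≥ 1 → (A : List ℤ) → Unique A → length A ≡ k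
    → MinIsZero A → gcdList A ≡ 1
    → ((k ≥ 3 ℕ.* h ℕ.+ 1) → (n : ℕ) → HasCard (InRestrictedSumset h A) n
    → + n ≡ (+ (h ℕ.* k) ℤ.- + (h ℕ.* h)) ℤ.+ + 2 → SubsetInterval A (+ 0) (+ k))
    × ((k ≥ 3 ℕ.* h ℕ.+ 3) → (n : ℕ) → HasCard (InRestrictedSumset h A) n
    → + n ≡ (+ (h ℕ.* k) ℤ.- + (h ℕ.* h)) ℤ.+ + 3 → SubsetInterval A (+ 0) (+ (k ℕ.+ 1)))
    × ((k ≥ 3 ℕ.* h ℕ.+ 4) → (n : ℕ) → HasCard (InRestrictedSumset h A) n
    → + n ≡ (+ (h ℕ.* k) ℤ.- + (h ℕ.* h)) ℤ.+ + 4 → SubsetInterval A (+ 0) (+ (k ℕ.+ 2)))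
theorem1p9 h k h≥3 _ A uA lenA min gcd≡1 =
    -- The three parts are `w = 2, 3, 4`. The bound needed is `k - h ≥ 2 * w + 2`, which `h ≥ 3`
    -- derives from each threshold; for `w = 4` it is attained at `h = 3`.
    (λ k≥ n card n≡ → interval h k 2 n A k h≥3 ≤!
      (linear 2 (λ h k → con 3 :≤ h ⇒ 3 :* h :+ con 1 :≤ k ⇒ ⊢ h :+ con 6 :≤ k) refl (h ∷ k ∷ []) h≥3 k≥)
      uA lenA min gcd≡1 card n≡ refl)
  , (λ k≥ n card n≡ → interval h k 3 n A (k + 1) h≥3 ≤!
      (linear 2 (λ h k → con 3 :≤ h ⇒ 3 :* h :+ con 3 :≤ k ⇒ ⊢ h :+ con 8 :≤ k) refl (h ∷ k ∷ []) h≥3 k≥)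
      uA lenA min gcd≡1 card n≡ (sym (+-assoc k 1 2)))
  , (λ k≥ n card n≡ → interval h k 4 n A (k + 2) h≥3 ≤!
      (linear 2 (λ h k → con 3 :≤ h ⇒ 3 :* h :+ con 4 :≤ k ⇒ ⊢ h :+ con 10 :≤ k) refl (h ∷ k ∷ []) h≥3 k≥)
      uA lenA min gcd≡1 card n≡ (sym (+-assoc k 2 2)))
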